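{- Let $t,d$ be positive integers and let $G=K_t^d$. Let $D$ be a loopless multigraph with $V(D)=V(K_t^d)$ and $\Delta(D)\le 2\lfloor\frac{t}{12}\rfloor-2$. Then $D$ is realizable in $G$.
   Context: $K_t^d$ is the $d$-fold Cartesian product $K_t\square\cdots\square K_t$: its vertex set is $\{1,\dots,t\}^d$ and two vertices are adjacent iff the corresponding vectors differ in exactly one coordinate. Given a simple graph $G$ and a multigraph $D$ with $V(D)=V(G)$, $D$ is realizable in $G$ if there exist pairwise edge-disjoint paths in $G$, one for each edge of $D$ (parallel edges counted separately), each joining the two endpoints of its edge. -}

module Defs where

open import Data.Nat using (ℕ; zero; suc; _+_)
open import Data.Fin using (Fin)
open import Data.Fin.Properties using () renaming (_≟_ to _≟F_)
open import Data.Vec using (Vec; lookup)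
open import Data.Vec.Properties using (≡-dec)
open import Data.List using (List; []; _∷_; length) renaming (lookup to lookupL)
open import Data.List.Membership.Propositional using (_∈_)
open import Data.List.Relation.Unary.Unique.Propositional using (Unique)
open import Data.Product using (Σ; _×_; _,_; ∃-syntax; proj₁; proj₂)
open import Data.Sum using (_⊎_)
open import Relation.Binary.PropositionalEquality using (_≡_; _≢_)
open import Relation.Nullary using (¬_; Dec; yes; no)

Vertex : ℕ → ℕ → Set
Vertex t d = Vec (Fin t) d

_≟V_ : ∀ {t d} → (u v : Vertex t d) → Dec (u ≡ v)
_≟V_ = ≡-dec _≟F_

Adj : ∀ {t d} → Vertex t d → Vertex t d → Set
Adj {t} {d} u v = ∃[ i ] (lookup u i ≢ lookup v i × (∀ j → j ≢ i → lookup u j ≡ lookup v j))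

data Walk {t d : ℕ} : Vertex t d → Vertex t d → Set where
  stop : ∀ x → Walk x x
  step : ∀ {x y z} → Adj x y → Walk y z → Walk x z

walkVertices : ∀ {t d} {x y : Vertex t d} → Walk x y → List (Vertex t d)
walkVertices (stop x) = x ∷ []
walkVertices (step {x = x} _ w) = x ∷ walkVertices w

walkEdges : ∀ {t d} {x y : Vertex t d} → Walk x y → List (Vertex t d × Vertex t d)
walkEdges (stop x) = []
walkEdges (step {x = x} {y = y} _ w) = (x , y) ∷ walkEdges w

IsPath : ∀ {t d} {x y : Vertex t d} → Walk x y → Set
IsPath w = Unique (walkVertices w)

ShareEdge : ∀ {t d} {x y x' y' : Vertex t d} → Walk x y → Walk x' y' → Set
ShareEdge {t} {d} p q = ∃[ a ] ∃[ b ] ((a , b) ∈ walkEdges p × ((a , b) ∈ walkEdges q ⊎ (b , a) ∈ walkEdges q))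

-- A multigraph D on V(K_t^d): a finite list of edges (parallel edges = repeated entries)
MultiGraph : ℕ → ℕ → Set
MultiGraph t d = List (Vertex t d × Vertex t d)

Loopless : ∀ {t d} → MultiGraph t d → Set
Loopless {t} {d} D = ∀ {e} → e ∈ D → proj₁ e ≢ proj₂ e

degree : ∀ {t d} → MultiGraph t d → Vertex t d → ℕ
degree [] v = 0
degree ((a , b) ∷ D) v with a ≟V v | b ≟V v
... | yes _ | _     = suc (degree D v)
... | no _  | yes _ = suc (degree D v)
... | no _  | no _  = degree D v

MaxDegreeAtMost : ∀ {t d} → MultiGraph t d → ℕ → Set
MaxDegreeAtMost {t} {d} D k = ∀ (v : Vertex t d) → degree D v Data.Nat.≤ k

Paths : ∀ {t d} → MultiGraph t d → Set
Paths D = (i : Fin (length D)) → Walk (proj₁ (lookupL D i)) (proj₂ (lookupL D i))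

Realizable : ∀ {t d} → MultiGraph t d → Set
Realizable D =
  Σ (Paths D) λ P → (∀ i → IsPath (P i)) ×
                    (∀ i j → i ≢ j → ¬ ShareEdge (P i) (P j))

{-# OPTIONS --safe #-}
module Submission where

-- Complete graphs: demands of maximum degree at most 2r on n ≥ 6r + 12 vertices can be met in Kₙ.  Orient the demands as
-- an Eulerian graph and split them, by König's theorem, into r matchings of out-ends to in-ends.  The cycles containing
-- the first two matchings are 3-edge-coloured with all colour classes of almost equal size.  For the first matching,
-- choose three vertices x₀, x₁, x₂ and route an edge uv of colour i as u xᵢ v.  A vertex v uses two of its three edges to
-- the xᵢ, and through the third one it takes over a demand of that xᵢ; as the colours are balanced, this gets rid of all
-- demands at x₀, x₁, x₂.  Doing the same for the second matching removes six vertices and lowers r by one.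
--
-- Grids: let q = ⌊t/12⌋ and k = 2q - 2.  Contracting the lines in one direction turns D into a multigraph of maximum
-- degree at most tk on the grid of lower dimension, which splits into t multigraphs of maximum degree at most k, one for
-- each layer.  It remains to connect, inside each line, the ends of the demands to their layers.  These demands have
-- degree at most 2k, so the theorem for complete graphs applies with r = k.

open import Defs
open import Data.Nat using (ℕ; zero; suc; _+_; _*_; _/_; _≤_; _<_; _≤?_; _<?_; z≤n; s≤s) renaming (_≟_ to _≟ℕ_)
open import Data.Nat.DivMod using (m/n*n≤m)
open import Data.Nat.Properties hiding (_≟_)
open import Data.Nat.Tactic.RingSolver using (solve-∀)
open import Data.Empty using (⊥-elim)
open import Data.Fin using (Fin; zero; suc)
open import Data.Fin.Properties using () renaming (_≟_ to _≟F_; suc-injective to F-suc-injective)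
open import Data.List using (List; []; _∷_; _++_; map; [_]; concat; concatMap; length; replicate; tabulate; allFin) renaming (lookup to lookupL)
open import Data.List.Properties using (map-++; map-∘; map-id; map-tabulate; ++-assoc; ++-identityʳ; length-map; length-replicate; length-++; length-tabulate; concatMap-++; concat-++; concat-map; tabulate-cong)
open import Data.List.Membership.DecPropositional using () renaming (_∈?_ to member?)
open import Data.List.Membership.Propositional using (_∈_; _∉_)
open import Data.List.Membership.Propositional.Properties using (∈-++⁻; ∈-++⁺ˡ; ∈-++⁺ʳ; ∈-∃++)
open import Data.List.Relation.Binary.Pointwise using (Pointwise; []; _∷_)
open import Data.List.Relation.Binary.Permutation.Propositional using (_↭_; refl; prep; swap; trans; ↭-refl; ↭-sym; ↭-trans; ↭-reflexive)
open import Data.List.Relation.Binary.Permutation.Propositional.Properties using (shift; drop-∷; ↭-length; ++⁺; ++⁺ˡ; ++⁺ʳ; ++-comm; All-resp-↭; ∈-resp-↭; ++-commutativeMonoid) renaming (map⁺ to ↭-map⁺)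
import Data.List.Relation.Binary.Permutation.Homogeneous as Hom
import Data.List.Relation.Binary.Permutation.Setoid as PermS
import Data.List.Relation.Binary.Permutation.Setoid.Properties as PermSP
open import Data.List.Relation.Unary.All using (All; []; _∷_; universal) renaming (map to mapAll)
import Data.List.Relation.Unary.All as All
import Data.List.Relation.Unary.All.Properties as All
open import Data.List.Relation.Unary.AllPairs using (AllPairs; []; _∷_)
import Data.List.Relation.Unary.AllPairs as AllPairs
import Data.List.Relation.Unary.AllPairs.Properties as AllPairs
open import Data.List.Relation.Unary.Any using (here; there)
open import Data.List.Relation.Unary.Unique.Propositional using (Unique)
open import Data.List.Relation.Unary.Unique.Propositional.Properties using (allFin⁺)
open import Data.Product using (∃; ∃₂; _×_; _,_; proj₁; proj₂) renaming (map to bimap)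
open import Data.Sum using (_⊎_; inj₁; inj₂) renaming (map to mapSum)
open import Data.Sum.Properties using (inj₁-injective; inj₂-injective) renaming (≡-dec to ⊎-≡-dec)
open import Data.Unit using (⊤; tt)
open import Data.Vec using ([]; _∷_; head; tail; lookup)
open import Data.Vec.Properties using (∷-injectiveˡ; ∷-injectiveʳ)
open import Function using (_∘_; id)
open import Relation.Binary.Bundles using (Setoid)
open import Relation.Binary.Definitions using (DecidableEquality)
open import Relation.Binary.PropositionalEquality using (_≡_; _≢_; refl; sym; cong; cong₂; subst; subst₂; module ≡-Reasoning) renaming (trans to ≡-trans)
open import Relation.Nullary using (¬_; Dec; yes; no)

-- Edge-disjoint routing

-- A round trades the two units of the degree bound that belong to its matching for the one demand
-- that each remaining vertex may take over. One round alone would leave the odd bound 2r - 1, for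
-- which an Eulerian orientation again gives r matchings; so the bound is lowered by two rounds at a
-- time, with both matchings fixed beforehand. The obstacle is that the second matching may meet the
-- three vertices that the first round removes. The constants come from counting takers. In either
-- round a vertex xᵢ has at most 2r - 2 demands to pass on, each to a different vertex whose edge to
-- xᵢ is free, and up to three such vertices may be barred. Three classes of this size give 6r plus
-- a constant; the 12 also pays for their imbalance and for the three vertices lost before the
-- second round. In a grid, a vertex of a line has up to k ends of its own and up to k more as the
-- entrance to its layer, hence r = k, and 6k + 12 ≤ t holds because 6(2q - 2) + 12 = 12q.

data _∼_ {A : Set} : A × A → A × A → Set where
  same : ∀ {e} → e ∼ e
  flip : ∀ {a b} → (a , b) ∼ (b , a)

∼-sym : ∀ {A : Set} {e f : A × A} → e ∼ f → f ∼ e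
∼-sym same = same
∼-sym flip = flip

∼-trans : ∀ {A : Set} {e f g : A × A} → e ∼ f → f ∼ g → e ∼ g
∼-trans same q = q
∼-trans flip same = flip
∼-trans flip flip = same

unordered : Set → Setoid _ _
unordered A = record
  { Carrier = A × A
  ; _≈_ = _∼_
  ; isEquivalence = record { refl = same ; sym = ∼-sym ; trans = ∼-trans }
  }

infix 3 _⇆_

-- Equality of undirected multigraphs given as lists of edges. Edges may be reversed because
-- orientations are chosen freely for undirected demands.
_⇆_ : {A : Set} → List (A × A) → List (A × A) → Set
_⇆_ {A} = PermS._↭_ (unordered A)

module _ {A : Set} where
  open PermS (unordered A) public using ()
    renaming (↭-refl to ⇆-refl; ↭-sym to ⇆-sym; ↭-trans to ⇆-trans)
  open PermSP (unordered A) public using ()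
    renaming (++⁺ to ⇆-++; ++⁺ˡ to ⇆-++ˡ; ++⁺ʳ to ⇆-++ʳ; All-resp-↭ to All-resp-⇆; AllPairs-resp-↭ to AllPairs-resp-⇆)

  ↭⇒⇆ : {D E : List (A × A)} → D ↭ E → D ⇆ E
  ↭⇒⇆ refl = ⇆-refl
  ↭⇒⇆ (prep e p) = Hom.prep same (↭⇒⇆ p)
  ↭⇒⇆ (swap e f p) = Hom.swap same same (↭⇒⇆ p)
  ↭⇒⇆ (trans p q) = Hom.trans (↭⇒⇆ p) (↭⇒⇆ q)

  ≡⇒⇆ : {D E : List (A × A)} → D ≡ E → D ⇆ E
  ≡⇒⇆ refl = ⇆-refl

  open import Algebra.Solver.CommutativeMonoid (PermSP.++-commutativeMonoid (unordered A)) public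
    using () renaming (solve to ⇆-solve; _⊜_ to _⇆⊜_; _⊕_ to _⇆⊕_)

-- A route may jump between any two vertices; which edges it may use is controlled only by the
-- resource `E` in `E ⊨ D`.
data Route {A : Set} : A → A → Set where
  stay : ∀ {u} → Route u u
  go   : ∀ {u v} w → Route w v → Route u v

module _ {A : Set} where

  edges : {u v : A} → Route u v → List (A × A)
  edges stay = []
  edges (go {u} w r) = (u , w) ∷ edges r

  glue : {u w v : A} → Route u w → Route w v → Route u v
  glue stay s = s
  glue (go x r) s = go x (glue r s)

  edges-glue : {u w v : A} (r : Route u w) (s : Route w v) → edges (glue r s) ≡ edges r ++ edges s
  edges-glue stay s = refl
  edges-glue (go x r) s = cong (_ ∷_) (edges-glue r s)

  back : {u v : A} → Route u v → Route v u
  back stay = stay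
  back (go {u} w r) = glue (back r) (go u stay)

  edges-back : {u v : A} (r : Route u v) → edges (back r) ⇆ edges r
  edges-back stay = ⇆-refl
  edges-back (go {u} w r) =
    ⇆-trans (≡⇒⇆ (edges-glue (back r) (go u stay)))
      (⇆-trans (⇆-++ (edges-back r) (Hom.prep flip ⇆-refl))
        (⇆-solve 2 (λ a b → (a ⇆⊕ b) ⇆⊜ (b ⇆⊕ a)) ⇆-refl (edges r) [ u , w ]))

  Routes : List (A × A) → Set
  Routes = All (λ e → Route (proj₁ e) (proj₂ e))

  used : ∀ {D} → Routes D → List (A × A)
  used [] = []
  used (r ∷ ρ) = edges r ++ used ρ

  -- E ⊨ D: the demands D are met by walks that together traverse each edge at most as often as E lists it.
  infix 3 _⊨_
  record _⊨_ (E D : List (A × A)) : Set where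
    constructor routing
    field
      routes : Routes D
      spare  : List (A × A)
      uses   : used routes ++ spare ⇆ E

  private
    turn : ∀ {e f} → e ∼ f → (r : Route (proj₁ e) (proj₂ e)) → ∃ λ (s : Route (proj₁ f) (proj₂ f)) → edges s ⇆ edges r
    turn same r = r , ⇆-refl
    turn flip r = back r , edges-back r

  permute : ∀ {D D'} → D ⇆ D' → (ρ : Routes D) → ∃ λ (ρ' : Routes D') → used ρ' ⇆ used ρ
  permute (Hom.refl []) [] = [] , ⇆-refl
  permute (Hom.refl (e∼f ∷ p)) (r ∷ ρ) with turn e∼f r | permute (Hom.refl p) ρ
  ... | s , q | ρ' , q' = s ∷ ρ' , ⇆-++ q q'
  permute (Hom.prep e∼f p) (r ∷ ρ) with turn e∼f r | permute p ρ
  ... | s , q | ρ' , q' = s ∷ ρ' , ⇆-++ q q'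
  permute (Hom.swap e∼f e'∼f' p) (r ∷ r' ∷ ρ) with turn e∼f r | turn e'∼f' r' | permute p ρ
  ... | s , q | s' , q' | ρ' , q'' = s' ∷ s ∷ ρ' ,
    ⇆-trans (⇆-++ q' (⇆-++ q q''))
      (⇆-solve 3 (λ a b c → (b ⇆⊕ (a ⇆⊕ c)) ⇆⊜ (a ⇆⊕ (b ⇆⊕ c))) ⇆-refl (edges r) (edges r') (used ρ))
  permute (Hom.trans p q) ρ with permute p ρ
  ... | ρ' , p' with permute q ρ'
  ... | ρ'' , q' = ρ'' , ⇆-trans q' p'

  module _ {E : List (A × A)} where

    ⊨-[] : E ⊨ []
    ⊨-[] = routing [] E ⇆-refl

    ⊨-perm : ∀ {D D'} → D ⇆ D' → E ⊨ D → E ⊨ D'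
    ⊨-perm p (routing ρ S u) with permute p ρ
    ... | ρ' , q = routing ρ' S (⇆-trans (⇆-++ʳ S q) u)

    ⊨-resource : ∀ {E' D} → E ⇆ E' → E ⊨ D → E' ⊨ D
    ⊨-resource p (routing ρ S u) = routing ρ S (⇆-trans u p)

    ⊨-weaken : ∀ {D} F → E ⊨ D → E ++ F ⊨ D
    ⊨-weaken F (routing ρ S u) = routing ρ (S ++ F)
      (⇆-trans (≡⇒⇆ (sym (++-assoc (used ρ) S F))) (⇆-++ʳ F u))

    ⊨-loop : ∀ {v D} → E ⊨ D → E ⊨ (v , v) ∷ D
    ⊨-loop (routing ρ S u) = routing (stay ∷ ρ) S u

    -- Read backwards, this splits a demand at an arbitrary vertex `w`. All rerouting below, through
    -- the vertices `xᵢ`, relays and layers, reduces to this rule.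
    ⊨-join : ∀ {u w v D} → E ⊨ (u , w) ∷ (w , v) ∷ D → E ⊨ (u , v) ∷ D
    ⊨-join (routing (r ∷ s ∷ ρ) S u) = routing (glue r s ∷ ρ) S
      (⇆-trans (≡⇒⇆ (cong (_++ S) (≡-trans (cong (_++ used ρ) (edges-glue r s))
        (++-assoc (edges r) (edges s) (used ρ))))) u)

  ⊨-edge : ∀ {e} → [ e ] ⊨ [ e ]
  ⊨-edge {u , v} = routing (go v stay ∷ []) [] ⇆-refl

  private
    joint : ∀ {C D} → Routes C → Routes D → Routes (C ++ D)
    joint [] σ = σ
    joint (r ∷ ρ) σ = r ∷ joint ρ σ

    used-joint : ∀ {C D} (ρ : Routes C) (σ : Routes D) → used (joint ρ σ) ≡ used ρ ++ used σ
    used-joint [] σ = refl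
    used-joint (r ∷ ρ) σ = ≡-trans (cong (edges r ++_) (used-joint ρ σ)) (sym (++-assoc (edges r) (used ρ) (used σ)))

  ⊨-++ : ∀ {E F C D} → E ⊨ C → F ⊨ D → E ++ F ⊨ C ++ D
  ⊨-++ {E} {F} (routing ρ S u) (routing σ T v) = routing (joint ρ σ) (S ++ T)
    (⇆-trans (≡⇒⇆ (cong (_++ (S ++ T)) (used-joint ρ σ)))
      (⇆-trans (⇆-solve 4 (λ a b c d → ((a ⇆⊕ b) ⇆⊕ (c ⇆⊕ d)) ⇆⊜ ((a ⇆⊕ c) ⇆⊕ (b ⇆⊕ d))) ⇆-refl (used ρ) (used σ) S T)
        (⇆-++ u v)))

  ⊨-drop : ∀ {E} C {D} → E ⊨ C ++ D → E ⊨ D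
  ⊨-drop [] x = x
  ⊨-drop (_ ∷ C) (routing (r ∷ ρ) S u) = ⊨-drop C (routing ρ (S ++ edges r)
    (⇆-trans (⇆-solve 3 (λ a b c → (b ⇆⊕ (c ⇆⊕ a)) ⇆⊜ ((a ⇆⊕ b) ⇆⊕ c)) ⇆-refl (edges r) (used ρ) S) u))

module _ {A B : Set} (f : A → B) where

  private
    f² : A × A → B × B
    f² = bimap f f

    f²-∼ : ∀ {e e'} → e ∼ e' → f² e ∼ f² e'
    f²-∼ same = same
    f²-∼ flip = flip

  ⇆-map : ∀ {D E} → D ⇆ E → map (bimap f f) D ⇆ map (bimap f f) E
  ⇆-map = PermSP.map⁺ (unordered A) (unordered B) f²-∼

  private
    mapRoute : ∀ {u v} → Route u v → Route (f u) (f v)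
    mapRoute stay = stay
    mapRoute (go w r) = go (f w) (mapRoute r)

    edges-map : ∀ {u v} (r : Route u v) → edges (mapRoute r) ≡ map f² (edges r)
    edges-map stay = refl
    edges-map (go w r) = cong (_ ∷_) (edges-map r)

    mapRoutes : ∀ {D} (ρ : Routes D) → ∃ λ (σ : Routes (map f² D)) → used σ ≡ map f² (used ρ)
    mapRoutes [] = [] , refl
    mapRoutes (r ∷ ρ) with mapRoutes ρ
    ... | σ , q = mapRoute r ∷ σ ,
      ≡-trans (cong (edges (mapRoute r) ++_) q) (≡-trans (cong (_++ map f² (used ρ)) (edges-map r)) (sym (map-++ f² (edges r) (used ρ))))

  ⊨-map : ∀ {D E} → E ⊨ D → map (bimap f f) E ⊨ map (bimap f f) D
  ⊨-map (routing ρ S u) with mapRoutes ρ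
  ... | σ , q = routing σ (map f² S)
    (⇆-trans (≡⇒⇆ (≡-trans (cong (_++ map f² S) q) (sym (map-++ f² (used ρ) S)))) (⇆-map u))

-- Degrees and Eulerian orientations

tally : {B : Set} → (B → ℕ) → List B → ℕ
tally f [] = 0
tally f (x ∷ xs) = f x + tally f xs

module _ {B : Set} where

  tally-++ : ∀ (f : B → ℕ) xs ys → tally f (xs ++ ys) ≡ tally f xs + tally f ys
  tally-++ f [] ys = refl
  tally-++ f (x ∷ xs) ys = ≡-trans (cong (f x +_) (tally-++ f xs ys)) (sym (+-assoc (f x) (tally f xs) (tally f ys)))

  tally-↭ : ∀ (f : B → ℕ) {xs ys} → xs ↭ ys → tally f xs ≡ tally f ys
  tally-↭ f refl = refl
  tally-↭ f (prep x p) = cong (f x +_) (tally-↭ f p)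
  tally-↭ f (swap x y p) = ≡-trans (cong (λ n → f x + (f y + n)) (tally-↭ f p)) (lemma (f x) (f y) _)
    where lemma : ∀ a b c → a + (b + c) ≡ b + (a + c)
          lemma = solve-∀
  tally-↭ f (trans p q) = ≡-trans (tally-↭ f p) (tally-↭ f q)

  tally-cong : ∀ {f g : B → ℕ} → (∀ x → f x ≡ g x) → ∀ xs → tally f xs ≡ tally g xs
  tally-cong eq [] = refl
  tally-cong eq (x ∷ xs) = cong₂ _+_ (eq x) (tally-cong eq xs)

  tally-mono : ∀ {f g : B → ℕ} → (∀ x → f x ≤ g x) → ∀ xs → tally f xs ≤ tally g xs
  tally-mono le [] = z≤n
  tally-mono le (x ∷ xs) = +-mono-≤ (le x) (tally-mono le xs)

  tally-+ : ∀ (f g : B → ℕ) xs → tally (λ x → f x + g x) xs ≡ tally f xs + tally g xs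
  tally-+ f g [] = refl
  tally-+ f g (x ∷ xs) = ≡-trans (cong (f x + g x +_) (tally-+ f g xs)) (lemma (f x) (g x) _ _)
    where lemma : ∀ a b c d → a + b + (c + d) ≡ a + c + (b + d)
          lemma = solve-∀

  tally-concat : ∀ (f : B → ℕ) xss → tally f (concat xss) ≡ tally (tally f) xss
  tally-concat f [] = refl
  tally-concat f (xs ∷ xss) = ≡-trans (tally-++ f xs (concat xss)) (cong (tally f xs +_) (tally-concat f xss))

  tally-zero : ∀ {f : B → ℕ} {xs} → All (λ x → f x ≡ 0) xs → tally f xs ≡ 0
  tally-zero [] = refl
  tally-zero (p ∷ ps) = cong₂ _+_ p (tally-zero ps)

  tally-one : ∀ {f : B → ℕ} {xs} → All (λ x → f x ≡ 1) xs → tally f xs ≡ length xs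
  tally-one [] = refl
  tally-one (p ∷ ps) = cong₂ _+_ p (tally-one ps)

tally-map : ∀ {B C : Set} (f : C → ℕ) (g : B → C) xs → tally f (map g xs) ≡ tally (f ∘ g) xs
tally-map f g [] = refl
tally-map f g (x ∷ xs) = cong (f (g x) +_) (tally-map f g xs)

concat-↭ : ∀ {B : Set} {xss yss : List (List B)} → xss ↭ yss → concat xss ↭ concat yss
concat-↭ refl = refl
concat-↭ (prep xs p) = ++⁺ˡ xs (concat-↭ p)
concat-↭ (swap {xss} {yss} xs ys p) = ↭-trans (↭-reflexive (sym (++-assoc xs ys (concat xss))))
  (↭-trans (++⁺ (++-comm xs ys) (concat-↭ p)) (↭-reflexive (++-assoc ys xs (concat yss))))
concat-↭ (trans p q) = ↭-trans (concat-↭ p) (concat-↭ q)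

module Indicator {A : Set} (_≟_ : DecidableEquality A) where

  δ : A → A → ℕ
  δ a v with a ≟ v
  ... | yes _ = 1
  ... | no _ = 0

  δ-≡ : ∀ {a v} → a ≡ v → δ a v ≡ 1
  δ-≡ {a} {v} eq with a ≟ v
  ... | yes _ = refl
  ... | no a≢v = ⊥-elim (a≢v eq)

  δ-≢ : ∀ {a v} → a ≢ v → δ a v ≡ 0
  δ-≢ {a} {v} neq with a ≟ v
  ... | yes a≡v = ⊥-elim (neq a≡v)
  ... | no _ = refl

-- Degrees are counted through a key, so that pairs of vertices can be read as edges between the classes of equal key.
module Keyed {A : Set} (_≟_ : DecidableEquality A) {B : Set} (κ : B → A) where

  open Indicator _≟_ public

  out inn deg : List (B × B) → A → ℕ
  out D v = tally (λ e → δ (κ (proj₁ e)) v) D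
  inn D v = tally (λ e → δ (κ (proj₂ e)) v) D
  deg D v = out D v + inn D v

  deg-∷ : ∀ a b D v → deg ((a , b) ∷ D) v ≡ δ (κ a) v + δ (κ b) v + deg D v
  deg-∷ a b D v = lemma (δ (κ a) v) (δ (κ b) v) (out D v) (inn D v)
    where lemma : ∀ a b c d → a + c + (b + d) ≡ a + b + (c + d)
          lemma = solve-∀

  deg-++ : ∀ D E v → deg (D ++ E) v ≡ deg D v + deg E v
  deg-++ D E v = ≡-trans (cong₂ _+_ (tally-++ _ D E) (tally-++ _ D E)) (lemma (out D v) (out E v) (inn D v) (inn E v))
    where lemma : ∀ a b c d → a + b + (c + d) ≡ a + c + (b + d)
          lemma = solve-∀

  private
    deg₁ : A → B × B → ℕ
    deg₁ v e = δ (κ (proj₁ e)) v + δ (κ (proj₂ e)) v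

    deg₁-∼ : ∀ v {e f} → e ∼ f → deg₁ v e ≡ deg₁ v f
    deg₁-∼ v same = refl
    deg₁-∼ v (flip {a} {b}) = +-comm (δ (κ a) v) (δ (κ b) v)

    tally-⇆ : ∀ v {D E} → D ⇆ E → tally (deg₁ v) D ≡ tally (deg₁ v) E
    tally-⇆ v (Hom.refl []) = refl
    tally-⇆ v (Hom.refl (p ∷ ps)) = cong₂ _+_ (deg₁-∼ v p) (tally-⇆ v (Hom.refl ps))
    tally-⇆ v (Hom.prep p q) = cong₂ _+_ (deg₁-∼ v p) (tally-⇆ v q)
    tally-⇆ v {_ ∷ _ ∷ _} {f ∷ e ∷ E} (Hom.swap p q r) rewrite deg₁-∼ v p | deg₁-∼ v q | tally-⇆ v r = lemma (deg₁ v e) (deg₁ v f) (tally (deg₁ v) E)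
      where lemma : ∀ a b c → a + (b + c) ≡ b + (a + c)
            lemma = solve-∀
    tally-⇆ v (Hom.trans p q) = ≡-trans (tally-⇆ v p) (tally-⇆ v q)

  deg-⇆ : ∀ {D E} → D ⇆ E → ∀ v → deg D v ≡ deg E v
  deg-⇆ {D} {E} p v = ≡-trans (sym (tally-+ _ _ D)) (≡-trans (tally-⇆ v p) (tally-+ _ _ E))

  Balanced : List (B × B) → Set
  Balanced D = ∀ v → out D v ≤ suc (inn D v) × inn D v ≤ suc (out D v)

  private
    data Touching (v : A) (D : List (B × B)) : Set where
      touching : ∀ b c D' → κ b ≡ v → D ⇆ (b , c) ∷ D' → length D ≡ suc (length D') → Touching v D
      apart    : deg D v ≡ 0 → Touching v D

    touch? : ∀ v D → Touching v D
    touch? v [] = apart refl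
    touch? v ((a , b) ∷ D) with κ a ≟ v | κ b ≟ v
    ... | yes p | _ = touching a b D p ⇆-refl refl
    ... | no _ | yes p = touching b a D p (Hom.prep flip ⇆-refl) refl
    ... | no ¬p | no ¬q with touch? v D
    ... | touching c d D' r s l = touching c d ((a , b) ∷ D') r
            (⇆-trans (Hom.prep same s) (Hom.swap same same ⇆-refl)) (cong suc l)
    ... | apart z = apart (≡-trans (deg-∷ a b D v) (cong₂ _+_ (cong₂ _+_ (δ-≢ ¬p) (δ-≢ ¬q)) z))

    -- Two edges meeting at b are oriented consistently by orienting the single edge that joins their other ends.
    orient∷ : ∀ n e D → length D ≤ n → ∃₂ λ f O → e ∼ f × D ⇆ O × Balanced (f ∷ O)
    orient : ∀ n D → length D ≤ n → ∃ λ O → D ⇆ O × Balanced O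

    orient n [] le = [] , ⇆-refl , λ v → z≤n , z≤n
    orient (suc n) (e ∷ D) (s≤s le) with orient∷ n e D le
    ... | f , O , p , q , bal = f ∷ O , Hom.prep p q , bal

    orient∷ n (a , b) D le with κ a ≟ κ b
    ... | yes p with orient n D le
    ... | O , q , bal = (a , b) , O , same , q , λ v → bal' v (bal v)
      where
      bal' : ∀ v → out O v ≤ suc (inn O v) × inn O v ≤ suc (out O v) →
             out ((a , b) ∷ O) v ≤ suc (inn ((a , b) ∷ O) v) × inn ((a , b) ∷ O) v ≤ suc (out ((a , b) ∷ O) v)
      bal' v (x , y) rewrite p = ≤-trans (+-monoʳ-≤ (δ (κ b) v) x) (≤-reflexive (+-suc _ _)) ,
                                 ≤-trans (+-monoʳ-≤ (δ (κ b) v) y) (≤-reflexive (+-suc _ _))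
    orient∷ n (a , b) D le | no a≢b with touch? (κ b) D
    orient∷ zero (a , b) [] le | no a≢b | touching b' c D' r s ()
    orient∷ (suc n) (a , b) D le | no a≢b | touching b' c D' r s l
      with orient∷ n (a , c) D' (≤-pred (subst (_≤ suc n) l le))
    ... | .(a , c) , O , same , q , bal = (a , b) , (b' , c) ∷ O , same , ⇆-trans s (Hom.prep same q) , bal'
      where
      lemma : ∀ x y z → x + (y + z) ≡ y + (x + z)
      lemma = solve-∀
      bal' : Balanced ((a , b) ∷ (b' , c) ∷ O)
      bal' v with bal v
      ... | x , y rewrite r | lemma (δ (κ a) v) (δ (κ b) v) (out O v) =
        ≤-trans (+-monoʳ-≤ (δ (κ b) v) x) (≤-reflexive (+-suc _ _)) ,
        ≤-trans (+-monoʳ-≤ (δ (κ b) v) y) (≤-reflexive (+-suc _ _))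
    ... | .(c , a) , O , flip , q , bal = (b , a) , (c , b') ∷ O , flip , ⇆-trans s (Hom.prep flip q) , bal'
      where
      lemma : ∀ x y z → x + (y + z) ≡ y + (x + z)
      lemma = solve-∀
      bal' : Balanced ((b , a) ∷ (c , b') ∷ O)
      bal' v with bal v
      ... | x , y rewrite r | lemma (δ (κ a) v) (δ (κ b) v) (inn O v) =
        ≤-trans (+-monoʳ-≤ (δ (κ b) v) x) (≤-reflexive (+-suc _ _)) ,
        ≤-trans (+-monoʳ-≤ (δ (κ b) v) y) (≤-reflexive (+-suc _ _))
    -- No other edge touches `κ b`, so balance holds there in either direction, and the direction is
    -- chosen to suit `κ a`.
    orient∷ n (a , b) D le | no a≢b | apart z with orient n D le
    ... | O , q , bal = choose (out O (κ a) ≤? inn O (κ a))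
      where
      z' : deg O (κ b) ≡ 0
      z' = ≡-trans (sym (deg-⇆ q (κ b))) z
      zo : out O (κ b) ≡ 0
      zo = m+n≡0⇒m≡0 (out O (κ b)) z'
      zi : inn O (κ b) ≡ 0
      zi = m+n≡0⇒n≡0 (out O (κ b)) z'
      balance : ∀ (p q : ℕ) → A → Set
      balance p q v = p ≤ suc q × q ≤ suc p
      forth : out O (κ a) ≤ inn O (κ a) → Balanced ((a , b) ∷ O)
      forth le v with κ a ≟ v | κ b ≟ v
      ... | yes refl | yes p = ⊥-elim (a≢b (sym p))
      ... | yes refl | no _ = s≤s le , m≤n⇒m≤1+n (proj₂ (bal v))
      ... | no _ | yes refl = subst₂ (λ x y → balance x (suc y) v) (sym zo) (sym zi) (z≤n , ≤-refl)
      ... | no _ | no _ = bal v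
      backwards : inn O (κ a) ≤ out O (κ a) → Balanced ((b , a) ∷ O)
      backwards le v with κ a ≟ v | κ b ≟ v
      ... | yes refl | yes p = ⊥-elim (a≢b (sym p))
      ... | yes refl | no _ = m≤n⇒m≤1+n (proj₁ (bal v)) , s≤s le
      ... | no _ | yes refl = subst₂ (λ x y → balance (suc x) y v) (sym zo) (sym zi) (≤-refl , z≤n)
      ... | no _ | no _ = bal v
      choose : Dec (out O (κ a) ≤ inn O (κ a)) → ∃₂ λ f O → (a , b) ∼ f × D ⇆ O × Balanced (f ∷ O)
      choose (yes le) = (a , b) , O , same , q , forth le
      choose (no ≰) = (b , a) , O , flip , q , backwards (<⇒≤ (≰⇒> ≰))

  balancedOrientation : ∀ D → ∃ λ O → D ⇆ O × Balanced O
  balancedOrientation D = orient (length D) D ≤-refl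

  -- The evenness of the bound does the work: `x ≥ r + 1` would force `y ≥ r`, hence a sum of at
  -- least `2 * r + 1`.
  halve : ∀ {r x y} → x ≤ suc y → x + y ≤ 2 * r → x ≤ r
  halve {r} {x} {y} x≤1+y le with x ≤? r
  ... | yes x≤r = x≤r
  ... | no x≰r = ⊥-elim (<-irrefl refl (≤-trans
    (≤-trans (≤-reflexive (lemma r)) (+-mono-≤ (≰⇒> x≰r) (≤-pred (≤-trans (≰⇒> x≰r) x≤1+y)))) le))
    where lemma : ∀ r → suc (2 * r) ≡ suc r + r
          lemma = solve-∀

  eulerian : ∀ r D → (∀ v → deg D v ≤ 2 * r) → ∃ λ O → D ⇆ O × (∀ v → out O v ≤ r) × (∀ v → inn O v ≤ r)
  eulerian r D le with balancedOrientation D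
  ... | O , p , bal = O , p ,
    (λ v → halve (proj₁ (bal v)) (≤-trans (≤-reflexive (sym (deg-⇆ p v))) (le v))) ,
    (λ v → halve (proj₂ (bal v)) (≤-trans (≤-reflexive (≡-trans (+-comm (inn O v) (out O v)) (sym (deg-⇆ p v)))) (le v)))

  OutIn≤ : ℕ → List (B × B) → Set
  OutIn≤ r D = (∀ v → out D v ≤ r) × (∀ v → inn D v ≤ r)

  -- A matching of the bipartite double cover, whose two sides are copies of the vertices for
  -- out-ends and in-ends. As a directed graph it consists of disjoint paths and cycles, possibly
  -- loops.
  Matching : List (B × B) → Set
  Matching = OutIn≤ 1

-- König's theorem

module Konig {A : Set} (_≟_ : DecidableEquality A) {B : Set} (κ : B → A) where

  open Keyed _≟_ κ

  private
    module Two = Keyed (⊎-≡-dec _≟_ _≟_) (mapSum κ κ)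

    bipartite : B × B → (B ⊎ B) × (B ⊎ B)
    bipartite (a , b) = inj₁ a , inj₂ b

    _↝_ : (B ⊎ B) × (B ⊎ B) → B × B → Set
    o ↝ e = bipartite e ∼ o

    lift : ∀ {D O E} → D ⇆ O → Pointwise _↝_ D E → ∃ λ F → E ↭ F × Pointwise _↝_ O F
    lift (Hom.refl []) [] = [] , refl , []
    lift (Hom.refl (p ∷ ps)) (q ∷ qs) with lift (Hom.refl ps) qs
    ... | F , r , rs = _ ∷ F , prep _ r , ∼-trans q p ∷ rs
    lift (Hom.prep p ps) (q ∷ qs) with lift ps qs
    ... | F , r , rs = _ ∷ F , prep _ r , ∼-trans q p ∷ rs
    lift (Hom.swap p p' ps) (q ∷ q' ∷ qs) with lift ps qs
    ... | F , r , rs = _ ∷ _ ∷ F , swap _ _ r , ∼-trans q' p' ∷ ∼-trans q p ∷ rs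
    lift (Hom.trans p p') qs with lift p qs
    ... | F , r , rs with lift p' rs
    ... | G , r' , rs' = G , trans r r' , rs'

    δ₁ : ∀ x v → Two.δ (inj₁ x) (inj₁ v) ≡ δ x v
    δ₁ x v = decide (x ≟ v)
      where
      decide : Dec (x ≡ v) → Two.δ (inj₁ x) (inj₁ v) ≡ δ x v
      decide (yes p) = ≡-trans (Two.δ-≡ (cong inj₁ p)) (sym (δ-≡ p))
      decide (no ¬p) = ≡-trans (Two.δ-≢ (¬p ∘ inj₁-injective)) (sym (δ-≢ ¬p))

    δ₂ : ∀ x v → Two.δ (inj₂ x) (inj₂ v) ≡ δ x v
    δ₂ x v = decide (x ≟ v)
      where
      decide : Dec (x ≡ v) → Two.δ (inj₂ x) (inj₂ v) ≡ δ x v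
      decide (yes p) = ≡-trans (Two.δ-≡ (cong inj₂ p)) (sym (δ-≡ p))
      decide (no ¬p) = ≡-trans (Two.δ-≢ (¬p ∘ inj₂-injective)) (sym (δ-≢ ¬p))

    -- The direction that an edge of the double cover receives in `O` is read as its colour:
    -- unreversed edges form `E₁`, reversed ones `E₂`. Hence the out- and in-degrees of `O` are the
    -- degrees in the two colours, with the roles exchanged on the right side, and balance says that
    -- the colours alternate.
    record Halves (O : List ((B ⊎ B) × (B ⊎ B))) (E : List (B × B)) : Set where
      constructor halves
      field
        E₁ E₂ : List (B × B)
        split : E ↭ E₁ ++ E₂
        out₁ : ∀ v → Two.out O (inj₁ v) ≡ out E₁ v
        out₂ : ∀ v → Two.inn O (inj₁ v) ≡ out E₂ v
        inn₁ : ∀ v → Two.inn O (inj₂ v) ≡ inn E₁ v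
        inn₂ : ∀ v → Two.out O (inj₂ v) ≡ inn E₂ v

    separate : ∀ {O E} → Pointwise _↝_ O E → Halves O E
    separate [] = halves [] [] refl (λ _ → refl) (λ _ → refl) (λ _ → refl) (λ _ → refl)
    separate {E = (a , b) ∷ _} (same ∷ ps) with separate ps
    ... | halves E₁ E₂ s o₁ o₂ i₁ i₂ = halves ((a , b) ∷ E₁) E₂ (prep _ s)
      (λ v → cong₂ _+_ (δ₁ (κ a) v) (o₁ v)) o₂ (λ v → cong₂ _+_ (δ₂ (κ b) v) (i₁ v)) i₂
    separate {E = (a , b) ∷ _} (flip ∷ ps) with separate ps
    ... | halves E₁ E₂ s o₁ o₂ i₁ i₂ = halves E₁ ((a , b) ∷ E₂)
      (↭-trans (prep _ s) (↭-sym (shift (a , b) E₁ E₂)))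
      o₁ (λ v → cong₂ _+_ (δ₁ (κ a) v) (o₂ v)) i₁ (λ v → cong₂ _+_ (δ₂ (κ b) v) (i₂ v))

    bipartition : ∀ E → Pointwise _↝_ (map bipartite E) E
    bipartition [] = []
    bipartition (e ∷ E) = same ∷ bipartition E

  out-++ : ∀ D E v → out (D ++ E) v ≡ out D v + out E v
  out-++ D E v = tally-++ _ D E

  inn-++ : ∀ D E v → inn (D ++ E) v ≡ inn D v + inn E v
  inn-++ D E v = tally-++ _ D E

  -- A balanced orientation of the bipartite double cover is an alternating 2-colouring.
  twoMatchings : ∀ E → OutIn≤ 2 E → ∃₂ λ E₁ E₂ → E ↭ E₁ ++ E₂ × Matching E₁ × Matching E₂
  twoMatchings E (o≤2 , i≤2) with Two.balancedOrientation (map bipartite E)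
  ... | O , p , bal with lift p (bipartition E)
  ... | F , q , ps with separate ps
  ... | halves E₁ E₂ s o₁ o₂ i₁ i₂ = E₁ , E₂ , E↭ ,
    ((λ v → halve (subst₂ (λ x y → x ≤ suc y) (o₁ v) (o₂ v) (proj₁ (bal (inj₁ v)))) (outs v)) ,
     (λ v → halve (subst₂ (λ x y → x ≤ suc y) (i₁ v) (i₂ v) (proj₂ (bal (inj₂ v)))) (inns v))) ,
    ((λ v → halve (subst₂ (λ x y → x ≤ suc y) (o₂ v) (o₁ v) (proj₂ (bal (inj₁ v))))
              (subst (_≤ 2) (+-comm (out E₁ v) (out E₂ v)) (outs v))) ,
     (λ v → halve (subst₂ (λ x y → x ≤ suc y) (i₂ v) (i₁ v) (proj₁ (bal (inj₂ v))))
              (subst (_≤ 2) (+-comm (inn E₁ v) (inn E₂ v)) (inns v))))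
    where
    E↭ : E ↭ E₁ ++ E₂
    E↭ = ↭-trans q s
    outs : ∀ v → out E₁ v + out E₂ v ≤ 2
    outs v = subst (_≤ 2) (≡-trans (tally-↭ _ E↭) (out-++ E₁ E₂ v)) (o≤2 v)
    inns : ∀ v → inn E₁ v + inn E₂ v ≤ 2
    inns v = subst (_≤ 2) (≡-trans (tally-↭ _ E↭) (inn-++ E₁ E₂ v)) (i≤2 v)

  private
    -- Pigeonhole, used to find a colour that is free at a given end of the new edge.
    pick : ∀ (f : List (B × B) → ℕ) Ms → tally f Ms < length Ms → ∃₂ λ M Ms' → Ms ↭ M ∷ Ms' × f M ≡ 0
    pick f (M ∷ Ms) lt with f M in eq
    ... | zero = M , Ms , refl , eq
    ... | suc k with pick f Ms (≤-trans (s≤s (m≤n+m (tally f Ms) k)) (≤-pred lt))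
    ... | N , Ms' , p , z = N , M ∷ Ms' , trans (prep M p) (swap M N refl) , z

    nonzero : ∀ {n} → n ≢ 0 → 1 ≤ n
    nonzero {zero} n≢0 = ⊥-elim (n≢0 refl)
    nonzero {suc n} _ = s≤s z≤n

    concat-replicate : ∀ r → concat (replicate r []) ≡ ([] {A = B × B})
    concat-replicate zero = refl
    concat-replicate (suc r) = concat-replicate r

    all-replicate : ∀ r → All Matching (replicate r [])
    all-replicate zero = []
    all-replicate (suc r) = ((λ v → z≤n) , λ v → z≤n) ∷ all-replicate r

    at-most-two : ∀ u w x y → (u ≡ w → x ≡ 0 ⊎ y ≡ 0) → x ≤ 1 → y ≤ 1 → δ u w + (x + y) ≤ 2
    at-most-two u w x y free x≤1 y≤1 with u ≟ w
    ... | no _ = +-mono-≤ x≤1 y≤1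
    ... | yes p with free p
    ... | inj₁ refl = s≤s y≤1
    ... | inj₂ refl = s≤s (subst (_≤ 1) (sym (+-identityʳ x)) x≤1)

  -- Insert the edges one at a time: if the colour M is free at the source and M' at the target, then M, M' and the new
  -- edge together have degrees at most 2, so that two matchings suffice for them.
  konig : ∀ r E → OutIn≤ r E → ∃ λ Ms → length Ms ≡ r × All Matching Ms × concat Ms ↭ E
  konig r [] _ = replicate r [] , length-replicate r , all-replicate r , ↭-reflexive (concat-replicate r)
  konig r ((a , b) ∷ E) (o≤r , i≤r)
    with konig r E ((λ v → m+n≤o⇒n≤o _ (o≤r v)) , (λ v → m+n≤o⇒n≤o _ (i≤r v)))
  ... | Ms , len , mat , p with pick (λ M → out M (κ a)) Ms (subst₂ _<_ (sym outs) (sym len) out<r)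
    where
    outs : tally (λ M → out M (κ a)) Ms ≡ out E (κ a)
    outs = ≡-trans (sym (tally-concat _ Ms)) (tally-↭ _ p)
    out<r : out E (κ a) < r
    out<r = subst (λ d → d + out E (κ a) ≤ r) (δ-≡ refl) (o≤r (κ a))
  ... | M , Ms' , q , free with inn M (κ b) ≟ℕ 0 | All-resp-↭ q mat
  ... | yes free' | (oM , iM) ∷ mat' = ((a , b) ∷ M) ∷ Ms' , ≡-trans (sym (↭-length q)) len ,
      ((λ v → extend (κ a) v (λ { refl → free }) (oM v)) , (λ v → extend (κ b) v (λ { refl → free' }) (iM v))) ∷ mat' ,
      prep _ (↭-trans (↭-sym (concat-↭ q)) p)
    where
    extend : ∀ u w {x} → (u ≡ w → x ≡ 0) → x ≤ 1 → δ u w + x ≤ 1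
    extend u w f x≤1 with u ≟ w
    ... | no _ = x≤1
    ... | yes eq rewrite f eq = ≤-refl
  ... | no inn≢0 | (oM , iM) ∷ mat' with pick (λ M → inn M (κ b)) Ms' fewer
    where
    inns : inn M (κ b) + tally (λ M → inn M (κ b)) Ms' ≡ inn E (κ b)
    inns = ≡-trans (sym (tally-↭ _ q)) (≡-trans (sym (tally-concat _ Ms)) (tally-↭ _ p))
    -- `M` already enters `κ b`, so of the at most r - 1 old edges entering it, at most r - 2 are
    -- left for the other r - 1 matchings.
    fewer : tally (λ M → inn M (κ b)) Ms' < length Ms'
    fewer = ≤-pred (≤-trans (s≤s (+-monoˡ-≤ _ (nonzero inn≢0)))
      (subst₂ _≤_ (cong suc (sym inns)) (≡-trans (sym len) (↭-length q))
        (subst (λ d → d + inn E (κ b) ≤ r) (δ-≡ refl) (i≤r (κ b)))))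
  ... | M' , Ms'' , q' , free' with All-resp-↭ q' mat'
  ... | (oM' , iM') ∷ mat'' with twoMatchings ((a , b) ∷ M ++ M')
      ((λ v → subst (λ d → δ (κ a) v + d ≤ 2) (sym (out-++ M M' v))
        (at-most-two (κ a) v _ _ (λ { refl → inj₁ free }) (oM v) (oM' v))) ,
       (λ v → subst (λ d → δ (κ b) v + d ≤ 2) (sym (inn-++ M M' v))
        (at-most-two (κ b) v _ _ (λ { refl → inj₂ free' }) (iM v) (iM' v))))
  ... | M₁ , M₂ , s , mat₁ , mat₂ = M₁ ∷ M₂ ∷ Ms'' ,
      ≡-trans (sym (≡-trans (↭-length q) (cong suc (↭-length q')))) len ,
      mat₁ ∷ mat₂ ∷ mat'' ,
      ↭-trans (↭-reflexive (sym (++-assoc M₁ M₂ (concat Ms''))))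
        (↭-trans (++⁺ʳ (concat Ms'') (↭-sym s))
          (prep _ (↭-trans (↭-reflexive (++-assoc M M' (concat Ms'')))
            (↭-trans (++⁺ˡ M (↭-sym (concat-↭ q'))) (↭-trans (↭-sym (concat-↭ q)) p)))))

  factorization : ∀ r D → (∀ v → deg D v ≤ 2 * r) →
                  ∃ λ Ms → length Ms ≡ r × All Matching Ms × D ⇆ concat Ms
  factorization r D le with eulerian r D le
  ... | O , p , o , i with konig r O (o , i)
  ... | Ms , len , mat , q = Ms , len , mat , ⇆-trans p (↭⇒⇆ (↭-sym q))

  deg-matchings : ∀ Ms → All Matching Ms → ∀ v → deg (concat Ms) v ≤ 2 * length Ms
  deg-matchings [] [] v = z≤n
  deg-matchings (M ∷ Ms) ((o , i) ∷ mat) v = begin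
    deg (M ++ concat Ms) v             ≡⟨ deg-++ M (concat Ms) v ⟩
    deg M v + deg (concat Ms) v        ≤⟨ +-mono-≤ (+-mono-≤ (o v) (i v)) (deg-matchings Ms mat v) ⟩
    2 + 2 * length Ms                  ≡⟨ sym (*-suc 2 (length Ms)) ⟩
    2 * suc (length Ms)                ∎
    where open ≤-Reasoning

-- Covering a matching by cycles

module Perm {A : Set} where
  open import Algebra.Solver.CommutativeMonoid (++-commutativeMonoid {A = A}) public
    using (solve; _⊜_; _⊕_)

module Cycles {A : Set} (_≟_ : DecidableEquality A) where

  open Keyed _≟_ {A} id

  link : A → List A → A → List (A × A)
  link u [] v = [ u , v ]
  link u (w ∷ ws) v = (u , w) ∷ link w ws v

  link-++ : ∀ u xs w ys v → link u (xs ++ w ∷ ys) v ≡ link u xs w ++ link w ys v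
  link-++ u [] w ys v = refl
  link-++ u (x ∷ xs) w ys v = cong (_ ∷_) (link-++ x xs w ys v)

  -- A single vertex counts as a cycle whose only arc is a loop. Thus a family of cycles covering
  -- every vertex once is a permutation of the vertices.
  Cycle : Set
  Cycle = A × List A

  arcs : List Cycle → List (A × A)
  arcs = concatMap (λ (u , us) → link u us u)

  vertices : List Cycle → List A
  vertices = concatMap (λ (u , us) → u ∷ us)

  rotateTo : ∀ Cs u → u ∈ vertices Cs →
             ∃₂ λ us Ds → vertices Cs ↭ u ∷ us ++ vertices Ds × arcs Cs ↭ link u us u ++ arcs Ds
  rotateTo ((c , cs) ∷ Cs) u u∈ with ∈-++⁻ (c ∷ cs) u∈
  ... | inj₁ (here refl) = cs , Cs , refl , refl
  ... | inj₁ (there u∈cs) with ∈-∃++ u∈cs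
  ... | xs , ys , refl = ys ++ c ∷ xs , Cs ,
    ++⁺ʳ (vertices Cs) (Perm.solve 4 (λ c xs u ys → (c ⊕ (xs ⊕ (u ⊕ ys))) ⊜ (u ⊕ (ys ⊕ (c ⊕ xs)))) ↭-refl [ c ] xs [ u ] ys) ,
    ++⁺ʳ (arcs Cs) (↭-trans (↭-reflexive (link-++ c xs u ys c))
      (↭-trans (++-comm (link c xs u) (link u ys c)) (↭-reflexive (sym (link-++ u ys c xs u)))))
    where open Perm
  rotateTo ((c , cs) ∷ Cs) u u∈ | inj₂ u∈Cs with rotateTo Cs u u∈Cs
  ... | us , Ds , p , q = us , (c , cs) ∷ Ds ,
    ↭-trans (++⁺ˡ (c ∷ cs) p)
      (Perm.solve 3 (λ cs us Ds → (cs ⊕ (us ⊕ Ds)) ⊜ (us ⊕ (cs ⊕ Ds))) ↭-refl (c ∷ cs) (u ∷ us) (vertices Ds)) ,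
    ↭-trans (++⁺ˡ (link c cs c) q)
      (Perm.solve 3 (λ cs us Ds → (cs ⊕ (us ⊕ Ds)) ⊜ (us ⊕ (cs ⊕ Ds))) ↭-refl (link c cs c) (link u us u) (arcs Ds))
    where open Perm

  private
    -- `l` and `K` do not depend on `v`, so changing the end of a path redirects only its last arc.
    lastArc : ∀ u us → ∃₂ λ l K → ∀ v → link u us v ↭ (l , v) ∷ K
    lastArc u [] = u , [] , λ v → refl
    lastArc u (w ∷ ws) with lastArc w ws
    ... | l , K , p = l , (u , w) ∷ K , λ v → trans (prep _ (p v)) (swap _ _ refl)

    no-out : ∀ {M u x} → out M u ≡ 0 → (u , x) ∉ M
    no-out {_ ∷ M} {u} z (here refl) with ≡-trans (sym (cong (_+ out M u) (δ-≡ refl))) z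
    ... | ()
    no-out {(a , _) ∷ M} {u} z (there e∈M) = no-out {M} (m+n≡0⇒n≡0 (δ a u) z) e∈M

    no-inn : ∀ {M l v} → inn M v ≡ 0 → (l , v) ∉ M
    no-inn {_ ∷ M} {v = v} z (here refl) with ≡-trans (sym (cong (_+ inn M v) (δ-≡ refl))) z
    ... | ()
    no-inn {(_ , b) ∷ M} {v = v} z (there e∈M) = no-inn {M} (m+n≡0⇒n≡0 (δ b v) z) e∈M

    remove : ∀ {f} K M {rest : List (A × A)} → f ∷ K ↭ M ++ rest → f ∉ M → ∃ λ ρ → K ↭ M ++ ρ
    remove {f} K M p f∉M with ∈-++⁻ M (∈-resp-↭ p (here refl))
    ... | inj₁ f∈M = ⊥-elim (f∉M f∈M)
    ... | inj₂ f∈rest with ∈-∃++ f∈rest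
    ... | xs , ys , refl = xs ++ ys , drop-∷ (↭-trans p
      (Perm.solve 4 (λ m x f y → (m ⊕ (x ⊕ (f ⊕ y))) ⊜ (f ⊕ (m ⊕ (x ⊕ y)))) ↭-refl M xs [ f ] ys))
      where open Perm

  -- The arcs `rest` are fillers that complete `M` to a permutation of `V`. They are routed together
  -- with `M` and dropped in `makeStage`.
  Extends : List A → List (A × A) → Set
  Extends V M = ∃ λ Cs → vertices Cs ↭ V × ∃ λ rest → arcs Cs ↭ M ++ rest

  -- Adding the arc (u , v) replaces the arcs (u , x) and (l , v) by (u , v) and (l , x), which merges two cycles or splits one.
  cycleCover : ∀ V M → Matching M → All (λ e → proj₁ e ∈ V × proj₂ e ∈ V) M → Extends V M
  cycleCover V [] _ _ = map (_, []) V , ↭-reflexive (singletons V) , _ , refl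
    where
    singletons : ∀ V → vertices (map (_, []) V) ≡ V
    singletons [] = refl
    singletons (v ∷ V) = cong (v ∷_) (singletons V)
  cycleCover V ((u , v) ∷ M) (o≤1 , i≤1) ((u∈V , v∈V) ∷ M∈V)
    with cycleCover V M ((λ w → m+n≤o⇒n≤o _ (o≤1 w)) , (λ w → m+n≤o⇒n≤o _ (i≤1 w))) M∈V
  ... | Cs , p , rest , q with rotateTo Cs u (∈-resp-↭ (↭-sym p) u∈V)
  ... | us , Ds , p' , q' = insert (∈-++⁻ (u ∷ us) (∈-resp-↭ (↭-trans (↭-sym p) p') v∈V))
    where
    open Perm
    old : link u us u ++ arcs Ds ↭ M ++ rest
    old = ↭-trans (↭-sym q') q

    V↭ : u ∷ us ++ vertices Ds ↭ V
    V↭ = ↭-trans (↭-sym p') p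

    u-free : out M u ≡ 0
    u-free = n≤0⇒n≡0 (≤-pred (subst (λ d → d + out M u ≤ 1) (δ-≡ refl) (o≤1 u)))

    v-free : inn M v ≡ 0
    v-free = n≤0⇒n≡0 (≤-pred (subst (λ d → d + inn M v ≤ 1) (δ-≡ refl) (i≤1 v)))

    present : ∀ {Es K} → vertices Es ↭ V → arcs Es ↭ (u , v) ∷ K → arcs Es ↭ M ++ rest → Extends V ((u , v) ∷ M)
    present {Es} {K} r s t with remove K M (↭-trans (↭-sym s) t) (no-out u-free)
    ... | ρ , k = Es , r , ρ , trans s (prep _ k)

    -- Neither the arc leaving `u` nor the one entering `v` belongs to `M`, since `u` is free as a
    -- source and `v` as a target; both are fillers and may be redirected.
    replace : ∀ {Es l x K} → vertices Es ↭ V → link u us u ++ arcs Ds ↭ (u , x) ∷ (l , v) ∷ K →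
              arcs Es ↭ (u , v) ∷ (l , x) ∷ K → Extends V ((u , v) ∷ M)
    replace {Es} {l} {x} {K} r s t with remove ((l , v) ∷ K) M (↭-trans (↭-sym s) old) (no-out u-free)
    ... | ρ , k with remove K M k (no-inn v-free)
    ... | ρ' , k' = Es , r , (l , x) ∷ ρ' , trans t (prep _ (trans (prep _ k') (↭-sym (shift (l , x) M ρ'))))

    insert : v ∈ u ∷ us ⊎ v ∈ vertices Ds → Extends V ((u , v) ∷ M)
    insert = place us refl
      where
      place : ∀ ws → us ≡ ws → v ∈ u ∷ us ⊎ v ∈ vertices Ds → Extends V ((u , v) ∷ M)
      place [] refl (inj₁ (here refl)) = present {(u , []) ∷ Ds} V↭ refl old
      place (x ∷ xs) refl (inj₁ (here refl)) with lastArc x xs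
      ... | l , K , r = replace {(u , []) ∷ (x , xs) ∷ Ds} {l} {x} {K ++ arcs Ds} V↭
        (prep _ (++⁺ʳ (arcs Ds) (r u))) (prep _ (++⁺ʳ (arcs Ds) (r x)))
      place ws refl (inj₁ (there v∈)) with ∈-∃++ v∈
      ... | [] , ys , refl = present {(u , v ∷ ys) ∷ Ds} V↭ refl old
      -- `v` lies further along the cycle of `u`: the stretch `x ∷ xs` between them is closed into a
      -- cycle of its own.
      ... | x ∷ xs , ys , refl with lastArc x xs
      ... | l , K , r = replace {(u , v ∷ ys) ∷ (x , xs) ∷ Ds} {l} {x} {K ++ link v ys u ++ arcs Ds}
        (↭-trans (prep u (Perm.solve 4 (λ x xs vys d → (vys ⊕ ((x ⊕ xs) ⊕ d)) ⊜ ((x ⊕ (xs ⊕ vys)) ⊕ d)) ↭-refl [ x ] xs (v ∷ ys) (vertices Ds))) V↭)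
        (prep _ (↭-trans (++⁺ʳ (arcs Ds) (↭-trans (↭-reflexive (link-++ x xs v ys u)) (++⁺ʳ (link v ys u) (r v))))
          (↭-reflexive (++-assoc ((l , v) ∷ K) (link v ys u) (arcs Ds)))))
        (prep _ (↭-trans (++⁺ˡ (link v ys u) (++⁺ʳ (arcs Ds) (r x)))
          (Perm.solve 4 (λ vys lx k d → (vys ⊕ ((lx ⊕ k) ⊕ d)) ⊜ (lx ⊕ (k ⊕ (vys ⊕ d)))) ↭-refl (link v ys u) [ l , x ] K (arcs Ds))))
      place ws eq (inj₂ v∈) with rotateTo Ds v v∈
      place [] refl (inj₂ v∈) | vs , Es , r , s with lastArc v vs
      ... | l , K , k = replace {(u , v ∷ vs) ∷ Es} {l} {u} {K ++ arcs Es}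
        (↭-trans (prep u (↭-sym r)) V↭)
        (prep _ (↭-trans s (++⁺ʳ (arcs Es) (k v))))
        (prep _ (++⁺ʳ (arcs Es) (k u)))
      place (x ∷ xs) refl (inj₂ v∈) | vs , Es , r , s with lastArc v vs
      ... | l , K , k = replace {(u , v ∷ vs ++ x ∷ xs) ∷ Es} {l} {x} {K ++ link x xs u ++ arcs Es}
        (↭-trans (prep u (↭-trans (Perm.solve 3 (λ vs xs e → ((vs ⊕ xs) ⊕ e) ⊜ (xs ⊕ (vs ⊕ e))) ↭-refl (v ∷ vs) (x ∷ xs) (vertices Es))
          (++⁺ˡ (x ∷ xs) (↭-sym r)))) V↭)
        (prep _ (↭-trans (++⁺ˡ (link x xs u) (↭-trans s (++⁺ʳ (arcs Es) (k v))))
          (Perm.solve 4 (λ xu lv k e → (xu ⊕ ((lv ⊕ k) ⊕ e)) ⊜ (lv ⊕ (k ⊕ (xu ⊕ e)))) ↭-refl (link x xs u) [ l , v ] K (arcs Es))))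
        (prep _ (↭-trans (++⁺ʳ (arcs Es) (↭-trans (↭-reflexive (link-++ v vs x xs u)) (++⁺ʳ (link x xs u) (k x))))
          (↭-reflexive (++-assoc ((l , x) ∷ K) (link x xs u) (arcs Es)))))

-- Balanced 3-edge-colourings of cycles

module Colours {A : Set} (_≟_ : DecidableEquality A) where

  open Cycles _≟_

  fans : A → A → List A → List (A × A)
  fans x y = concatMap (λ v → (v , x) ∷ (v , y) ∷ [])

  -- Colour i means routing through xᵢ; Sᵢ collects the vertices that do not use colour i.
  Lifts : List (A × A) → List A → List A → List A → Set
  Lifts D S₀ S₁ S₂ = ∀ x₀ x₁ x₂ → fans x₁ x₂ S₀ ++ fans x₀ x₂ S₁ ++ fans x₀ x₁ S₂ ⊨ D

  private
    open Perm using (_⊕_; _⊜_)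

    bend : (u v x : A) → (u , x) ∷ (v , x) ∷ [] ⊨ [ u , v ]
    bend u v x = ⊨-resource (Hom.prep same (Hom.prep flip ⇆-refl))
      (⊨-join (⊨-++ (⊨-edge {e = u , x}) (⊨-edge {e = x , v})))

    -- The first edge has colour 0 and the last one the colour selected by `End`. The class of the
    -- two ends is left open until the path is closed into a cycle.
    record Path (u : A) (ws : List A) (v : A) (End : A → A → A → A) (n₀ n₁ n₂ : ℕ) : Set where
      constructor path
      field
        S₀ S₁ S₂ : List A
        inner : ws ↭ S₀ ++ S₁ ++ S₂
        size₀ : length S₀ ≡ n₀
        size₁ : length S₁ ≡ n₁
        size₂ : length S₂ ≡ n₂
        lifts : ∀ x₀ x₁ x₂ →
          (u , x₀) ∷ (v , End x₀ x₁ x₂) ∷ fans x₁ x₂ S₀ ++ fans x₀ x₂ S₁ ++ fans x₀ x₁ S₂ ⊨ link u ws v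

    first second third : A → A → A → A
    first x y z = x
    second x y z = y
    third x y z = z

    -- The constructors correspond to cycles of length 2, 0 and 1 modulo three. On closing the path,
    -- the common end joins the class of the colour that is neither 0 nor the one given by `End`.
    data Coloured (u : A) (ws : List A) (v : A) : Set where
      short  : ∀ m → Path u ws v second m m (suc m) → Coloured u ws v
      even   : ∀ m → Path u ws v third (suc m) m (suc m) → Coloured u ws v
      long   : ∀ m → Path u ws v third m (suc m) (2 + m) → Coloured u ws v

    path₁ : ∀ u a v → Path u (a ∷ []) v second 0 0 1
    path₁ u a v = path [] [] [ a ] refl refl refl refl λ x y z →
      ⊨-resource (↭⇒⇆ (Perm.solve 4 (λ ux ax ay vy → ((ux ⊕ ax) ⊕ (ay ⊕ vy)) ⊜ (ux ⊕ (vy ⊕ (ax ⊕ ay)))) refl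
          [ u , x ] [ a , x ] [ a , y ] [ v , y ]))
        (⊨-++ (bend u a x) (bend a v y))

    path₂ : ∀ u a b v → Path u (a ∷ b ∷ []) v third 1 0 1
    path₂ u a b v = path [ b ] [] [ a ] (swap a b refl) refl refl refl λ x y z →
      ⊨-resource (↭⇒⇆ (Perm.solve 6 (λ ux ax ay by bz vz → ((ux ⊕ ax) ⊕ ((ay ⊕ by) ⊕ (bz ⊕ vz))) ⊜ (ux ⊕ (vz ⊕ ((by ⊕ bz) ⊕ (ax ⊕ ay))))) refl
          [ u , x ] [ a , x ] [ a , y ] [ b , y ] [ b , z ] [ v , z ]))
        (⊨-++ (bend u a x) (⊨-++ (bend a b y) (bend b v z)))

    -- The colours are 0, 1, 0, 2. Continuing periodically with 0, 1, 2, 0 would give both edges at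
    -- the common end the same colour once the path is closed.
    path₃ : ∀ u a b c v → Path u (a ∷ b ∷ c ∷ []) v third 0 1 2
    path₃ u a b c v = path [] [ c ] (a ∷ b ∷ []) (trans (prep a (swap b c refl)) (swap a c refl)) refl refl refl λ x y z →
      ⊨-resource (↭⇒⇆ (Perm.solve 8 (λ ux ax ay by bx cx cz vz →
          ((ux ⊕ ax) ⊕ ((ay ⊕ by) ⊕ ((bx ⊕ cx) ⊕ (cz ⊕ vz)))) ⊜ (ux ⊕ (vz ⊕ ((cx ⊕ cz) ⊕ ((ax ⊕ ay) ⊕ (bx ⊕ by)))))) refl
          [ u , x ] [ a , x ] [ a , y ] [ b , y ] [ b , x ] [ c , x ] [ c , z ] [ v , z ]))
        (⊨-++ (bend u a x) (⊨-++ (bend a b y) (⊨-++ (bend b c x) (bend c v z))))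

    prolong : ∀ {c ws v End n₀ n₁ n₂} u a b → Path c ws v End n₀ n₁ n₂ →
              Path u (a ∷ b ∷ c ∷ ws) v End (suc n₀) (suc n₁) (suc n₂)
    prolong {c} {ws} {v} {End} u a b (path S₀ S₁ S₂ p s₀ s₁ s₂ l) = path (b ∷ S₀) (c ∷ S₁) (a ∷ S₂)
      (↭-trans (prep a (prep b (prep c p)))
        (Perm.solve 6 (λ a b c S₀ S₁ S₂ → (a ⊕ (b ⊕ (c ⊕ (S₀ ⊕ (S₁ ⊕ S₂))))) ⊜ ((b ⊕ S₀) ⊕ ((c ⊕ S₁) ⊕ (a ⊕ S₂)))) refl
          [ a ] [ b ] [ c ] S₀ S₁ S₂))
      (cong suc s₀) (cong suc s₁) (cong suc s₂) λ x y z →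
      ⊨-resource (↭⇒⇆ (Perm.solve 11 (λ ux ax ay by bz cz cx ve f₀ f₁ f₂ →
          ((ux ⊕ ax) ⊕ ((ay ⊕ by) ⊕ ((bz ⊕ cz) ⊕ (cx ⊕ (ve ⊕ (f₀ ⊕ (f₁ ⊕ f₂))))))) ⊜
          (ux ⊕ (ve ⊕ ((by ⊕ (bz ⊕ f₀)) ⊕ ((cx ⊕ (cz ⊕ f₁)) ⊕ (ax ⊕ (ay ⊕ f₂))))))) refl
          [ u , x ] [ a , x ] [ a , y ] [ b , y ] [ b , z ] [ c , z ] [ c , x ] [ v , End x y z ]
          (fans y z S₀) (fans x z S₁) (fans x y S₂)))
        (⊨-++ (bend u a x) (⊨-++ (bend a b y) (⊨-++ (bend b c z) (l x y z))))

    -- Consecutive edges are coloured 0, 1, 2, 0, 1, 2, …, with a last period of length two, three or four.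
    colour : ∀ u a ws v → Coloured u (a ∷ ws) v
    colour u a [] v = short 0 (path₁ u a v)
    colour u a (b ∷ []) v = even 0 (path₂ u a b v)
    colour u a (b ∷ c ∷ []) v = long 0 (path₃ u a b c v)
    colour u a (b ∷ c ∷ d ∷ ws) v with colour c d ws v
    ... | short m p = short (suc m) (prolong u a b p)
    ... | even m p = even (suc m) (prolong u a b p)
    ... | long m p = long (suc m) (prolong u a b p)

  record Classes (V : List A) (D : List (A × A)) (R : ℕ → ℕ → ℕ → Set) : Set where
    constructor classes
    field
      S₀ S₁ S₂ : List A
      cover : V ↭ S₀ ++ S₁ ++ S₂
      lifts : Lifts D S₀ S₁ S₂
      sizes : R (length S₀) (length S₁) (length S₂)

  Near : ℕ → ℕ → Set
  Near m n = m ≤ n + 2 × n ≤ m + 2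

  near-sym : ∀ {m n} → Near m n → Near n m
  near-sym (a , b) = b , a

  Even Sorted : ℕ → ℕ → ℕ → Set
  Even l₀ l₁ l₂ = Near l₀ l₁ × Near l₀ l₂ × Near l₁ l₂
  Sorted l₀ l₁ l₂ = Even l₀ l₁ l₂ × l₁ ≤ l₀ × l₂ ≤ l₁

  private
    -- The class sizes that a single cycle can have, listed in increasing order: surplus 1 comes
    -- from a loop, surplus 2 from length 2 modulo three, surplus 0 from length 0, and `first-less`
    -- from length 1 modulo three, starting at 4.
    data Sizes : ℕ → ℕ → ℕ → Set where
      last-more  : ∀ m k → k ≤ 2 → Sizes m m (m + k)
      first-less : ∀ m → Sizes m (m + 2) (m + 2)

    resize : ∀ {l₀ l₁ l₂ n₀ n₁ n₂} → l₀ ≡ n₀ → l₁ ≡ n₁ → l₂ ≡ n₂ → Sizes n₀ n₁ n₂ → Sizes l₀ l₁ l₂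
    resize refl refl refl s = s

    oneCycle : ∀ u us → Classes (u ∷ us) (link u us u) Sizes
    oneCycle u [] = classes [] [] [ u ] refl (λ _ _ _ → ⊨-loop ⊨-[]) (last-more 0 1 (s≤s z≤n))
    oneCycle u (a ∷ ws) with colour u a ws u
    ... | short m (path S₀ S₁ S₂ p s₀ s₁ s₂ l) = classes S₀ S₁ (u ∷ S₂)
      (↭-trans (prep u p) (Perm.solve 4 (λ u s₀ s₁ s₂ → (u ⊕ (s₀ ⊕ (s₁ ⊕ s₂))) ⊜ (s₀ ⊕ (s₁ ⊕ (u ⊕ s₂)))) refl [ u ] S₀ S₁ S₂))
      (λ x y z → ⊨-resource (↭⇒⇆ (Perm.solve 5 (λ u u' f₀ f₁ f₂ → (u ⊕ (u' ⊕ (f₀ ⊕ (f₁ ⊕ f₂)))) ⊜ (f₀ ⊕ (f₁ ⊕ (u ⊕ (u' ⊕ f₂))))) refl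
        [ u , x ] [ u , y ] (fans y z S₀) (fans x z S₁) (fans x y S₂))) (l x y z))
      (resize s₀ s₁ (≡-trans (cong suc s₂) (+-comm 2 m)) (last-more m 2 ≤-refl))
    ... | even m (path S₀ S₁ S₂ p s₀ s₁ s₂ l) = classes S₀ (u ∷ S₁) S₂
      (↭-trans (prep u p) (Perm.solve 4 (λ u s₀ s₁ s₂ → (u ⊕ (s₀ ⊕ (s₁ ⊕ s₂))) ⊜ (s₀ ⊕ ((u ⊕ s₁) ⊕ s₂))) refl [ u ] S₀ S₁ S₂))
      (λ x y z → ⊨-resource (↭⇒⇆ (Perm.solve 5 (λ u u' f₀ f₁ f₂ → (u ⊕ (u' ⊕ (f₀ ⊕ (f₁ ⊕ f₂)))) ⊜ (f₀ ⊕ ((u ⊕ (u' ⊕ f₁)) ⊕ f₂))) refl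
        [ u , x ] [ u , z ] (fans y z S₀) (fans x z S₁) (fans x y S₂))) (l x y z))
      (resize s₀ (cong suc s₁) (≡-trans s₂ (sym (+-identityʳ _))) (last-more (suc m) 0 z≤n))
    ... | long m (path S₀ S₁ S₂ p s₀ s₁ s₂ l) = classes S₀ (u ∷ S₁) S₂
      (↭-trans (prep u p) (Perm.solve 4 (λ u s₀ s₁ s₂ → (u ⊕ (s₀ ⊕ (s₁ ⊕ s₂))) ⊜ (s₀ ⊕ ((u ⊕ s₁) ⊕ s₂))) refl [ u ] S₀ S₁ S₂))
      (λ x y z → ⊨-resource (↭⇒⇆ (Perm.solve 5 (λ u u' f₀ f₁ f₂ → (u ⊕ (u' ⊕ (f₀ ⊕ (f₁ ⊕ f₂)))) ⊜ (f₀ ⊕ ((u ⊕ (u' ⊕ f₁)) ⊕ f₂))) refl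
        [ u , x ] [ u , z ] (fans y z S₀) (fans x z S₁) (fans x y S₂))) (l x y z))
      (resize s₀ (≡-trans (cong suc s₁) (+-comm 2 m)) (≡-trans s₂ (+-comm 2 m)) (first-less m))

    fans-swap : ∀ x y S → fans x y S ↭ fans y x S
    fans-swap x y [] = refl
    fans-swap x y (v ∷ S) = swap _ _ (fans-swap x y S)

    -- `Lifts` holds for all choices of the three routing vertices, so the colours may be renamed
    -- freely.
    swap₀₁ : ∀ {V D R R'} (c : Classes V D R) →
             R' (length (Classes.S₁ c)) (length (Classes.S₀ c)) (length (Classes.S₂ c)) → Classes V D R'
    swap₀₁ (classes S₀ S₁ S₂ p l _) = classes S₁ S₀ S₂
      (↭-trans p (Perm.solve 3 (λ a b c → (a ⊕ (b ⊕ c)) ⊜ (b ⊕ (a ⊕ c))) refl S₀ S₁ S₂))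
      (λ x y z → ⊨-resource (↭⇒⇆ (↭-trans
        (Perm.solve 3 (λ a b c → (a ⊕ (b ⊕ c)) ⊜ (b ⊕ (a ⊕ c))) refl (fans x z S₀) (fans y z S₁) (fans y x S₂))
        (++⁺ˡ (fans y z S₁) (++⁺ˡ (fans x z S₀) (fans-swap y x S₂))))) (l y x z))

    swap₁₂ : ∀ {V D R R'} (c : Classes V D R) →
             R' (length (Classes.S₀ c)) (length (Classes.S₂ c)) (length (Classes.S₁ c)) → Classes V D R'
    swap₁₂ (classes S₀ S₁ S₂ p l _) = classes S₀ S₂ S₁
      (↭-trans p (Perm.solve 3 (λ a b c → (a ⊕ (b ⊕ c)) ⊜ (a ⊕ (c ⊕ b))) refl S₀ S₁ S₂))
      (λ x y z → ⊨-resource (↭⇒⇆ (↭-trans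
        (Perm.solve 3 (λ a b c → (a ⊕ (b ⊕ c)) ⊜ (a ⊕ (c ⊕ b))) refl (fans z y S₀) (fans x y S₁) (fans x z S₂))
        (++⁺ʳ _ (fans-swap z y S₀)))) (l x z y))

    Unsized : ℕ → ℕ → ℕ → Set
    Unsized _ _ _ = ⊤

    sorted : ∀ {V D} → Classes V D Even → Classes V D Sorted
    sorted c@(classes S₀ S₁ S₂ p l e@(e₀₁ , e₀₂ , e₁₂))
      with ≤-total (length S₁) (length S₀) | ≤-total (length S₂) (length S₁) | ≤-total (length S₂) (length S₀)
    ... | inj₁ 1≤0 | inj₁ 2≤1 | _ = classes S₀ S₁ S₂ p l (e , 1≤0 , 2≤1)
    ... | inj₁ 1≤0 | inj₂ 1≤2 | inj₁ 2≤0 = swap₁₂ c ((e₀₂ , e₀₁ , near-sym e₁₂) , 2≤0 , 1≤2)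
    ... | inj₁ 1≤0 | inj₂ 1≤2 | inj₂ 0≤2 = swap₀₁ (swap₁₂ {R' = Unsized} c tt)
          ((near-sym e₀₂ , near-sym e₁₂ , e₀₁) , 0≤2 , 1≤0)
    ... | inj₂ 0≤1 | inj₁ 2≤1 | inj₁ 2≤0 = swap₀₁ c ((near-sym e₀₁ , e₁₂ , e₀₂) , 0≤1 , 2≤0)
    ... | inj₂ 0≤1 | inj₁ 2≤1 | inj₂ 0≤2 = swap₁₂ (swap₀₁ {R' = Unsized} c tt)
          ((e₁₂ , near-sym e₀₁ , near-sym e₀₂) , 2≤1 , 0≤2)
    ... | inj₂ 0≤1 | inj₂ 1≤2 | _ = swap₀₁ (swap₁₂ {R' = Unsized} (swap₀₁ {R' = Unsized} c tt) tt)
          ((near-sym e₁₂ , near-sym e₀₂ , near-sym e₀₁) , 1≤2 , 0≤1)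

    raise : ∀ {l n a b} → l ≤ n + 2 → a ≤ b → l + a ≤ n + b + 2
    raise {l} {n} {a} {b} p q = ≤-trans (+-mono-≤ p q) (≤-reflexive (lemma n b))
      where lemma : ∀ n b → n + 2 + b ≡ n + b + 2
            lemma = solve-∀

    lower : ∀ {l n a b} → l ≤ n → a ≤ b + 2 → l + a ≤ n + b + 2
    lower {l} {n} {a} {b} p q = ≤-trans (+-mono-≤ p q) (≤-reflexive (sym (+-assoc n b 2)))

    -- Decreasing sizes are added to increasing ones: each difference is the sum of two of opposite
    -- sign and absolute value at most 2, so it stays within 2. This is why the colours are sorted
    -- before every new cycle.
    even-+ : ∀ {l₀ l₁ l₂ n₀ n₁ n₂} → Sorted l₀ l₁ l₂ → Sizes n₀ n₁ n₂ → Even (l₀ + n₀) (l₁ + n₁) (l₂ + n₂)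
    even-+ (((a , a') , (b , b') , (c , c')) , 1≤0 , 2≤1) (last-more m k k≤2) =
      (raise a ≤-refl , raise a' ≤-refl) ,
      (raise b (m≤m+n m k) , lower (≤-trans 2≤1 1≤0) (+-monoʳ-≤ m k≤2)) ,
      (raise c (m≤m+n m k) , lower 2≤1 (+-monoʳ-≤ m k≤2))
    even-+ (((a , a') , (b , b') , (c , c')) , 1≤0 , 2≤1) (first-less m) =
      (raise a (m≤m+n m 2) , lower 1≤0 ≤-refl) ,
      (raise b (m≤m+n m 2) , lower (≤-trans 2≤1 1≤0) ≤-refl) ,
      (raise c ≤-refl , raise c' ≤-refl)

    addCycle : ∀ {V W D C} → Classes V D Sorted → Classes W C Sizes → Classes (W ++ V) (C ++ D) Even
    addCycle (classes S₀ S₁ S₂ p l s) (classes T₀ T₁ T₂ q k t) = classes (S₀ ++ T₀) (S₁ ++ T₁) (S₂ ++ T₂)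
      (↭-trans (++⁺ q p) (regroup S₀ S₁ S₂ T₀ T₁ T₂))
      (λ x y z → ⊨-resource (↭⇒⇆ (↭-trans (regroup (fans y z S₀) (fans x z S₁) (fans x y S₂) (fans y z T₀) (fans x z T₁) (fans x y T₂))
        (↭-reflexive (sym (cong₂ _++_ (concatMap-++ _ S₀ T₀) (cong₂ _++_ (concatMap-++ _ S₁ T₁) (concatMap-++ _ S₂ T₂)))))))
        (⊨-++ (k x y z) (l x y z)))
      (subst₂ (λ f g → f g) (cong₂ Even (sym (length-++ S₀)) (sym (length-++ S₁))) (sym (length-++ S₂)) (even-+ s t))
      where
      regroup : ∀ {B : Set} (a b c d e f : List B) → (d ++ e ++ f) ++ (a ++ b ++ c) ↭ (a ++ d) ++ (b ++ e) ++ (c ++ f)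
      regroup = Perm.solve 6 (λ a b c d e f → ((d ⊕ (e ⊕ f)) ⊕ (a ⊕ (b ⊕ c))) ⊜ ((a ⊕ d) ⊕ ((b ⊕ e) ⊕ (c ⊕ f)))) refl

  evenClasses : ∀ Cs → Classes (vertices Cs) (arcs Cs) Even
  evenClasses [] = classes [] [] [] refl (λ _ _ _ → ⊨-[]) ((z≤n , z≤n) , (z≤n , z≤n) , (z≤n , z≤n))
  evenClasses ((u , us) ∷ Cs) = addCycle (sorted (evenClasses Cs)) (oneCycle u us)

-- Complete graphs

module Complete {A : Set} (_≟_ : DecidableEquality A) where

  open Keyed _≟_ {A} id
  open Konig _≟_ {A} id
  open Cycles _≟_
  open Colours _≟_

  μ : List A → A → ℕ
  μ V v = tally (λ w → δ w v) V

  Distinct : List A → Set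
  Distinct V = ∀ v → μ V v ≤ 1

  On : List A → List (A × A) → Set
  On V D = ∀ v → μ V v ≡ 0 → deg D v ≡ 0

  μ-++ : ∀ V W v → μ (V ++ W) v ≡ μ V v + μ W v
  μ-++ V W v = tally-++ _ V W

  δ-sym : ∀ u v → δ u v ≡ δ v u
  δ-sym u v = decide (u ≟ v)
    where
    decide : Dec (u ≡ v) → δ u v ≡ δ v u
    decide (yes refl) = refl
    decide (no u≢v) = ≡-trans (δ-≢ u≢v) (sym (δ-≢ (u≢v ∘ sym)))

  present : ∀ V {v} → μ V v ≢ 0 → v ∈ V
  present [] μ≢0 = ⊥-elim (μ≢0 refl)
  present (w ∷ V) {v} μ≢0 with w ≟ v
  ... | yes refl = here refl
  ... | no _ = there (present V μ≢0)

  -- With loops, an edge at x that is routed through x itself needs no special treatment.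
  pairs : List A → List (A × A)
  pairs [] = []
  pairs (x ∷ V) = map (x ,_) (x ∷ V) ++ pairs V

  pairs-↭ : ∀ {V W} → V ↭ W → pairs V ⇆ pairs W
  pairs-↭ refl = ⇆-refl
  pairs-↭ (prep x p) = ⇆-++ (↭⇒⇆ (↭-map⁺ (x ,_) (prep x p))) (pairs-↭ p)
  pairs-↭ (swap {V} {W} x y p) = ⇆-trans
    (⇆-solve 6 (λ xx xy xV yy yV E → ((xx ⇆⊕ (xy ⇆⊕ xV)) ⇆⊕ ((yy ⇆⊕ yV) ⇆⊕ E)) ⇆⊜ (xy ⇆⊕ ((yy ⇆⊕ yV) ⇆⊕ ((xx ⇆⊕ xV) ⇆⊕ E)))) ⇆-refl
      [ x , x ] [ x , y ] (map (x ,_) V) [ y , y ] (map (y ,_) V) (pairs V))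
    (⇆-trans (Hom.prep flip (⇆-++ (↭⇒⇆ (↭-map⁺ (y ,_) (prep y p))) (⇆-++ (↭⇒⇆ (↭-map⁺ (x ,_) (prep x p))) (pairs-↭ p))))
    (⇆-solve 5 (λ yx yy yW xxW E → (yx ⇆⊕ ((yy ⇆⊕ yW) ⇆⊕ (xxW ⇆⊕ E))) ⇆⊜ ((yy ⇆⊕ (yx ⇆⊕ yW)) ⇆⊕ (xxW ⇆⊕ E))) ⇆-refl
      [ y , x ] [ y , y ] (map (y ,_) W) (map (x ,_) (x ∷ W)) (pairs W)))
  pairs-↭ (trans p q) = ⇆-trans (pairs-↭ p) (pairs-↭ q)

  record Stage (V : List A) (M : List (A × A)) (s : ℕ) : Set where
    constructor stage
    field
      x₀ x₁ x₂ : A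
      T₀ T₁ T₂ : List A
    rest : List A
    rest = T₀ ++ T₁ ++ T₂
    field
      cover : V ↭ x₀ ∷ x₁ ∷ x₂ ∷ rest
      large₀ : s ≤ length T₀
      large₁ : s ≤ length T₁
      large₂ : s ≤ length T₂
      resolve : ∀ {D} → (map (x₀ ,_) T₀ ++ map (x₁ ,_) T₁ ++ map (x₂ ,_) T₂) ++ pairs rest ⊨ D → pairs V ⊨ M ++ D

  private
    fans-stars : ∀ x y T → fans x y T ⇆ map (x ,_) T ++ map (y ,_) T
    fans-stars x y [] = ⇆-refl
    fans-stars x y (v ∷ T) = ⇆-trans (Hom.prep flip (Hom.prep flip (fans-stars x y T)))
      (⇆-solve 4 (λ a b c d → (a ⇆⊕ (b ⇆⊕ (c ⇆⊕ d))) ⇆⊜ ((a ⇆⊕ c) ⇆⊕ (b ⇆⊕ d))) ⇆-refl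
        [ x , v ] [ y , v ] (map (x ,_) T) (map (y ,_) T))

    map-++₃ : ∀ (x : A) (T₀ T₁ T₂ : List A) → map (x ,_) (T₀ ++ T₁ ++ T₂) ≡ map (x ,_) T₀ ++ map (x ,_) T₁ ++ map (x ,_) T₂
    map-++₃ x T₀ T₁ T₂ = ≡-trans (map-++ (x ,_) T₀ (T₁ ++ T₂)) (cong (map (x ,_) T₀ ++_) (map-++ (x ,_) T₁ T₂))

    -- The vertex xᵢ misses colour i - 1, so the three of them use each edge x₀x₁, x₁x₂, x₂x₀ once.
    distribute : ∀ x₀ x₁ x₂ T₀ T₁ T₂ →
      (fans x₁ x₂ (x₁ ∷ T₀) ++ fans x₀ x₂ (x₂ ∷ T₁) ++ fans x₀ x₁ (x₀ ∷ T₂)) ++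
        ((map (x₀ ,_) T₀ ++ map (x₁ ,_) T₁ ++ map (x₂ ,_) T₂) ++ pairs (T₀ ++ T₁ ++ T₂)) ⇆
      pairs (x₀ ∷ x₁ ∷ x₂ ∷ T₀ ++ T₁ ++ T₂)
    distribute x₀ x₁ x₂ T₀ T₁ T₂ =
      ⇆-trans (⇆-++ʳ slots (⇆-++ (Hom.prep same (Hom.prep same (fans-stars x₁ x₂ T₀)))
                (⇆-++ (Hom.prep flip (Hom.prep same (fans-stars x₀ x₂ T₁)))
                  (Hom.prep same (Hom.prep same (fans-stars x₀ x₁ T₂))))))
      (⇆-trans (⇆-solve 16 (λ e₀₀ e₀₁ e₀₂ e₁₁ e₁₂ e₂₂ s₀₀ s₀₁ s₀₂ s₁₀ s₁₁ s₁₂ s₂₀ s₂₁ s₂₂ P →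
          (((e₁₁ ⇆⊕ (e₁₂ ⇆⊕ (s₁₀ ⇆⊕ s₂₀))) ⇆⊕ ((e₀₂ ⇆⊕ (e₂₂ ⇆⊕ (s₀₁ ⇆⊕ s₂₁))) ⇆⊕ (e₀₀ ⇆⊕ (e₀₁ ⇆⊕ (s₀₂ ⇆⊕ s₁₂)))))
            ⇆⊕ ((s₀₀ ⇆⊕ (s₁₁ ⇆⊕ s₂₂)) ⇆⊕ P)) ⇆⊜
          ((e₀₀ ⇆⊕ (e₀₁ ⇆⊕ (e₀₂ ⇆⊕ (s₀₀ ⇆⊕ (s₀₁ ⇆⊕ s₀₂))))) ⇆⊕ ((e₁₁ ⇆⊕ (e₁₂ ⇆⊕ (s₁₀ ⇆⊕ (s₁₁ ⇆⊕ s₁₂)))) ⇆⊕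
            ((e₂₂ ⇆⊕ (s₂₀ ⇆⊕ (s₂₁ ⇆⊕ s₂₂))) ⇆⊕ P)))) ⇆-refl
          [ x₀ , x₀ ] [ x₀ , x₁ ] [ x₀ , x₂ ] [ x₁ , x₁ ] [ x₁ , x₂ ] [ x₂ , x₂ ]
          (map (x₀ ,_) T₀) (map (x₀ ,_) T₁) (map (x₀ ,_) T₂)
          (map (x₁ ,_) T₀) (map (x₁ ,_) T₁) (map (x₁ ,_) T₂)
          (map (x₂ ,_) T₀) (map (x₂ ,_) T₁) (map (x₂ ,_) T₂) (pairs (T₀ ++ T₁ ++ T₂)))
        (≡⇒⇆ (sym (cong₂ _++_ (cong (λ l → (x₀ , x₀) ∷ (x₀ , x₁) ∷ (x₀ , x₂) ∷ l) (map-++₃ x₀ T₀ T₁ T₂))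
          (cong₂ _++_ (cong (λ l → (x₁ , x₁) ∷ (x₁ , x₂) ∷ l) (map-++₃ x₁ T₀ T₁ T₂))
            (cong (λ l → (x₂ , x₂) ∷ l ++ pairs (T₀ ++ T₁ ++ T₂)) (map-++₃ x₂ T₀ T₁ T₂)))))))
      where
      slots : List (A × A)
      slots = (map (x₀ ,_) T₀ ++ map (x₁ ,_) T₁ ++ map (x₂ ,_) T₂) ++ pairs (T₀ ++ T₁ ++ T₂)

    -- A class of size at most `s` would limit the total to s + 2(s + 2) = 3s + 4. The strict
    -- inequality reserves one vertex of each class to become some `xᵢ`.
    smallest : ∀ {l₀ l₁ l₂ n s} → l₀ + (l₁ + l₂) ≡ n → 3 * s + 5 ≤ n → l₁ ≤ l₀ + 2 → l₂ ≤ l₀ + 2 → s < l₀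
    smallest {l₀} {l₁} {l₂} {n} {s} refl le p q with s <? l₀
    ... | yes s<l₀ = s<l₀
    ... | no s≮l₀ = ⊥-elim (<-irrefl refl (≤-trans (≤-trans (≤-reflexive (lemma s)) le)
        (+-mono-≤ l₀≤s (+-mono-≤ (≤-trans p (+-monoˡ-≤ 2 l₀≤s)) (≤-trans q (+-monoˡ-≤ 2 l₀≤s))))))
      where
      l₀≤s : l₀ ≤ s
      l₀≤s = ≮⇒≥ s≮l₀
      lemma : ∀ s → suc (s + (s + 2 + (s + 2))) ≡ 3 * s + 5
      lemma = solve-∀

    uncons : ∀ {s} (S : List A) → s < length S → ∃₂ λ x T → S ≡ x ∷ T × s ≤ length T
    uncons (x ∷ T) (s≤s le) = x , T , refl , le

    ends : ∀ {V} M → On V M → All (λ e → proj₁ e ∈ V × proj₂ e ∈ V) M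
    ends {V} M M-on = All.tabulate λ {e} e∈M → present V (out≢0 M e∈M ∘ m+n≡0⇒m≡0 _ ∘ M-on _) , present V (inn≢0 M e∈M ∘ m+n≡0⇒n≡0 (out M _) ∘ M-on _)
      where
      out≢0 : ∀ M {e} → e ∈ M → out M (proj₁ e) ≢ 0
      out≢0 (e ∷ M) (here refl) z with ≡-trans (sym (δ-≡ {proj₁ e} refl)) (m+n≡0⇒m≡0 _ z)
      ... | ()
      out≢0 (f ∷ M) (there e∈M) z = out≢0 M e∈M (m+n≡0⇒n≡0 (δ (proj₁ f) _) z)
      inn≢0 : ∀ M {e} → e ∈ M → inn M (proj₂ e) ≢ 0
      inn≢0 (e ∷ M) (here refl) z with ≡-trans (sym (δ-≡ {proj₂ e} refl)) (m+n≡0⇒m≡0 _ z)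
      ... | ()
      inn≢0 (f ∷ M) (there e∈M) z = inn≢0 M e∈M (m+n≡0⇒n≡0 (δ (proj₂ f) _) z)

  makeStage : ∀ V M s → Matching M → On V M → 3 * s + 5 ≤ length V → Stage V M s
  makeStage V M s mat M-on le with cycleCover V M mat (ends M M-on)
  ... | Cs , p , rest , q with evenClasses Cs
  ... | classes S₀ S₁ S₂ c l (n₀₁ , n₀₂ , n₁₂) = build (uncons S₀ (smallest total le (proj₂ n₀₁) (proj₂ n₀₂)))
      (uncons S₁ (smallest (≡-trans (lemma₁ (length S₀) (length S₁) (length S₂)) total) le (proj₁ n₀₁) (proj₂ n₁₂)))
      (uncons S₂ (smallest (≡-trans (lemma₂ (length S₀) (length S₁) (length S₂)) total) le (proj₁ n₀₂) (proj₁ n₁₂)))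
    where
    open Perm
    V↭ : V ↭ S₀ ++ S₁ ++ S₂
    V↭ = ↭-trans (↭-sym p) c
    total : length S₀ + (length S₁ + length S₂) ≡ length V
    total = ≡-trans (sym (≡-trans (length-++ S₀) (cong (length S₀ +_) (length-++ S₁)))) (sym (↭-length V↭))
    lemma₁ : ∀ a b c → b + (a + c) ≡ a + (b + c)
    lemma₁ = solve-∀
    lemma₂ : ∀ a b c → c + (a + b) ≡ a + (b + c)
    lemma₂ = solve-∀
    build : (∃₂ λ x T → S₀ ≡ x ∷ T × s ≤ length T) → (∃₂ λ x T → S₁ ≡ x ∷ T × s ≤ length T) →
            (∃₂ λ x T → S₂ ≡ x ∷ T × s ≤ length T) → Stage V M s
    -- The choice is shifted cyclically: with every `xᵢ` taken from `Sᵢ`, each edge between two of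
    -- them would be used twice.
    build (x₁ , T₀ , refl , le₀) (x₂ , T₁ , refl , le₁) (x₀ , T₂ , refl , le₂) =
      stage x₀ x₁ x₂ T₀ T₁ T₂ V↭' le₀ le₁ le₂ λ d →
        ⊨-resource (⇆-trans (distribute x₀ x₁ x₂ T₀ T₁ T₂) (⇆-sym (pairs-↭ V↭')))
          (⊨-++ (⊨-keep (⊨-perm (↭⇒⇆ q) (l x₀ x₁ x₂))) d)
      where
      ⊨-keep : ∀ {E} → E ⊨ M ++ rest → E ⊨ M
      ⊨-keep e = ⊨-drop rest (⊨-perm (↭⇒⇆ (++-comm M rest)) e)
      V↭' : V ↭ x₀ ∷ x₁ ∷ x₂ ∷ T₀ ++ T₁ ++ T₂
      V↭' = ↭-trans V↭ (Perm.solve 6 (λ x₀ x₁ x₂ t₀ t₁ t₂ → ((x₁ ⊕ t₀) ⊕ ((x₂ ⊕ t₁) ⊕ (x₀ ⊕ t₂))) ⊜ (x₀ ⊕ (x₁ ⊕ (x₂ ⊕ (t₀ ⊕ (t₁ ⊕ t₂)))))) ↭-refl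
        [ x₀ ] [ x₁ ] [ x₂ ] T₀ T₁ T₂)

-- Passing demands on to other vertices

module Relays {A : Set} (_≟_ : DecidableEquality A) where

  open Keyed _≟_ {A} id
  open Konig _≟_ {A} id
  open Complete _≟_

  -- A demand of `x` with other end `b` is moved to `z` and `b`, with a new `z` from `T` each time.
  -- `C` holds demands set aside, so that further edges and further vertices can be treated in turn.
  -- The bound `self` allows for `x` itself lying in `T`.
  record Sent (x : A) (T : List A) (D : List (A × A)) : Set where
    constructor sent
    field
      D'     : List (A × A)
      route  : ∀ {E} C → E ⊨ C ++ D' → map (x ,_) T ++ E ⊨ C ++ D
      others : ∀ v → x ≢ v → deg D' v ≤ deg D v + μ T v
      self   : deg D' x ≤ μ T x

  private
    detour : ∀ {E} {x z b : A} {D} C → E ⊨ (C ++ [ z , b ]) ++ D → (x , z) ∷ E ⊨ C ++ (x , b) ∷ D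
    detour {x = x} {z} {b} {D} C e = ⊨-perm
      (⇆-solve 3 (λ xb c d → (xb ⇆⊕ (c ⇆⊕ d)) ⇆⊜ (c ⇆⊕ (xb ⇆⊕ d))) ⇆-refl [ x , b ] C D)
      (⊨-join (⊨-++ (⊨-edge {e = x , z}) (⊨-perm
        (⇆-solve 3 (λ zb c d → ((c ⇆⊕ zb) ⇆⊕ d) ⇆⊜ (zb ⇆⊕ (c ⇆⊕ d))) ⇆-refl [ z , b ] C D) e)))

    assoc⁻ : ∀ {E} {f : A × A} {D} C → E ⊨ C ++ f ∷ D → E ⊨ (C ++ [ f ]) ++ D
    assoc⁻ {f = f} {D} C = ⊨-perm (≡⇒⇆ (sym (++-assoc C [ f ] D)))

    assoc : ∀ {E} {f : A × A} {D} C → E ⊨ (C ++ [ f ]) ++ D → E ⊨ C ++ f ∷ D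
    assoc {f = f} {D} C = ⊨-perm (≡⇒⇆ (++-assoc C [ f ] D))

    shuffle : ∀ a b d t → a + b + (d + t) ≡ b + d + (a + t)
    shuffle = solve-∀

  send : ∀ x T D → deg D x ≤ length T → Sent x T D
  send x T [] le = sent [] (λ {E} C e → ⊨-resource (↭⇒⇆ (++-comm E (map (x ,_) T))) (⊨-weaken (map (x ,_) T) e))
    (λ v _ → z≤n) z≤n
  send x T ((a , b) ∷ D) le rewrite deg-∷ a b D x with a ≟ x | b ≟ x
  send x T ((a , b) ∷ D) le | no a≢x | no b≢x with send x T D le
  ... | sent D' r o s = sent ((a , b) ∷ D') (λ C e → assoc C (r (C ++ [ a , b ]) (assoc⁻ C e))) o'
        (subst (_≤ μ T x) (sym (≡-trans (deg-∷ a b D' x) (cong₂ (λ i j → i + j + deg D' x) (δ-≢ a≢x) (δ-≢ b≢x)))) s)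
    where
    o' : ∀ v → x ≢ v → deg ((a , b) ∷ D') v ≤ deg ((a , b) ∷ D) v + μ T v
    o' v x≢v rewrite deg-∷ a b D' v | deg-∷ a b D v | +-assoc (δ a v + δ b v) (deg D v) (μ T v) = +-monoʳ-≤ (δ a v + δ b v) (o v x≢v)
  send x (z ∷ T) ((a , b) ∷ D) (s≤s le) | yes refl | no b≢x with send x T D le
  ... | sent D' r o s = sent ((z , b) ∷ D') (λ C e → detour C (r (C ++ [ z , b ]) (assoc⁻ C e))) o' s'
    where
    o' : ∀ v → x ≢ v → deg ((z , b) ∷ D') v ≤ deg ((x , b) ∷ D) v + μ (z ∷ T) v
    o' v x≢v rewrite deg-∷ z b D' v | deg-∷ x b D v | δ-≢ x≢v =
      ≤-trans (+-monoʳ-≤ (δ z v + δ b v) (o v x≢v)) (≤-reflexive (shuffle (δ z v) (δ b v) (deg D v) (μ T v)))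
    s' : deg ((z , b) ∷ D') x ≤ μ (z ∷ T) x
    s' rewrite deg-∷ z b D' x | δ-≢ b≢x | +-identityʳ (δ z x) = +-monoʳ-≤ (δ z x) s
  send x (z ∷ T) ((a , b) ∷ D) (s≤s le) | no a≢x | yes refl with send x T D le
  ... | sent D' r o s = sent ((z , a) ∷ D')
        (λ C e → ⊨-perm (⇆-++ˡ C (Hom.prep flip ⇆-refl)) (detour C (r (C ++ [ z , a ]) (assoc⁻ C e)))) o' s'
    where
    o' : ∀ v → x ≢ v → deg ((z , a) ∷ D') v ≤ deg ((a , x) ∷ D) v + μ (z ∷ T) v
    o' v x≢v rewrite deg-∷ z a D' v | deg-∷ a x D v | δ-≢ x≢v | +-identityʳ (δ a v) =
      ≤-trans (+-monoʳ-≤ (δ z v + δ a v) (o v x≢v)) (≤-reflexive (shuffle (δ z v) (δ a v) (deg D v) (μ T v)))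
    s' : deg ((z , a) ∷ D') x ≤ μ (z ∷ T) x
    s' rewrite deg-∷ z a D' x | δ-≢ a≢x | +-identityʳ (δ z x) = +-monoʳ-≤ (δ z x) s
  send x T ((a , b) ∷ D) le | yes refl | yes refl with send x T D (≤-trans (m≤n+m _ 2) le)
  ... | sent D' r o s = sent D'
        (λ C e → ⊨-perm (⇆-solve 3 (λ l c d → (l ⇆⊕ (c ⇆⊕ d)) ⇆⊜ (c ⇆⊕ (l ⇆⊕ d))) ⇆-refl [ x , x ] C D) (⊨-loop (r C e)))
        (λ v x≢v → ≤-trans (o v x≢v) (+-monoˡ-≤ (μ T v) (≤-trans (m≤n+m (deg D v) (δ x v + δ x v)) (≤-reflexive (sym (deg-∷ x x D v)))))) s

  μ-↭ : ∀ {V W} → V ↭ W → ∀ v → μ V v ≡ μ W v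
  μ-↭ p v = tally-↭ _ p

  -- Since `T` has no repetitions, each entry of `E` costs at most one vertex. The discarded
  -- vertices are kept in `X`, as their edges must be accounted for as spare.
  avoiding : ∀ E T → Distinct T → ∃₂ λ K X →
             T ↭ K ++ X × length T ≤ length K + length E × (∀ v → μ E v ≡ 0 ⊎ μ K v ≡ 0)
  avoiding [] T _ = T , [] , ↭-reflexive (sym (++-identityʳ T)) , m≤m+n _ _ , λ _ → inj₁ refl
  avoiding (e ∷ E) T T-distinct with avoiding E T T-distinct
  ... | K , X , p , le , free with μ K e ≟ℕ 0
  ... | yes z = K , X , p , ≤-trans le (+-monoʳ-≤ (length K) (n≤1+n _)) , free'
    where
    free' : ∀ v → δ e v + μ E v ≡ 0 ⊎ μ K v ≡ 0
    free' v with e ≟ v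
    ... | yes refl = inj₂ z
    ... | no _ = free v
  ... | no μ≢0 with ∈-∃++ (present K μ≢0)
  ... | as , bs , refl = as ++ bs , e ∷ X ,
        trans p (Perm.solve 4 (λ a e b x → ((a ⊕ (e ⊕ b)) ⊕ x) ⊜ ((a ⊕ b) ⊕ (e ⊕ x))) refl as [ e ] bs X) ,
        ≤-trans le (≤-reflexive (≡-trans (cong (_+ length E) (↭-length K↭)) (sym (+-suc _ _)))) , free'
    where
    open Perm using (_⊕_; _⊜_)
    K↭ : as ++ e ∷ bs ↭ e ∷ as ++ bs
    K↭ = shift e as bs
    μK : ∀ v → δ e v + μ (as ++ bs) v ≡ μ (as ++ e ∷ bs) v
    μK v = sym (μ-↭ K↭ v)
    K≤1 : μ (as ++ e ∷ bs) e ≤ 1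
    K≤1 = m+n≤o⇒m≤o _ (subst (_≤ 1) (≡-trans (μ-↭ p e) (μ-++ (as ++ e ∷ bs) X e)) (T-distinct e))
    gone : μ (as ++ bs) e ≡ 0
    gone = n≤0⇒n≡0 (≤-pred (subst (λ d → d + μ (as ++ bs) e ≤ 1) (δ-≡ refl) (subst (_≤ 1) (sym (μK e)) K≤1)))
    free' : ∀ v → δ e v + μ E v ≡ 0 ⊎ μ (as ++ bs) v ≡ 0
    free' v with e ≟ v
    ... | yes refl = inj₂ gone
    ... | no _ with free v
    ... | inj₁ z = inj₁ z
    ... | inj₂ z = inj₂ (m+n≡0⇒n≡0 (δ e v) (≡-trans (μK v) z))

  module _ {V M s} (st : Stage V M s) where
    open Stage st

    removed : List A
    removed = x₀ ∷ x₁ ∷ x₂ ∷ []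

    -- One round: `E` lists the vertices barred from taking over a demand, `K` those that may take
    -- one over, and `N` is set aside for the next round.
    record Relay (E : List A) (C : List (A × A)) : Set where
      field
        K : List A
        C' : List (A × A)
        route : ∀ N → pairs rest ⊨ N ++ C' → pairs V ⊨ M ++ N ++ C
        K≤rest : ∀ v → μ K v ≤ μ rest v
        avoids : ∀ v → μ E v ≡ 0 ⊎ μ K v ≡ 0
        degree-kept : ∀ v → μ removed v ≡ 0 → deg C' v ≤ deg C v + μ K v
        degree-removed : ∀ v → μ removed v ≢ 0 → deg C' v ≡ 0

    μ-cover : ∀ v → μ V v ≡ μ removed v + μ rest v
    μ-cover v = ≡-trans (μ-↭ cover v) (μ-++ removed rest v)

    module _ (V-distinct : Distinct V) where

      once : ∀ v → μ removed v + μ rest v ≤ 1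
      once v = subst (_≤ 1) (μ-cover v) (V-distinct v)

      rest-distinct : Distinct rest
      rest-distinct v = m+n≤o⇒n≤o _ (once v)

      removed∩rest : ∀ v → μ removed v ≢ 0 → μ rest v ≡ 0
      removed∩rest v μ≢0 with μ removed v | once v
      ... | zero | _ = ⊥-elim (μ≢0 refl)
      ... | suc n | s≤s le = m+n≡0⇒n≡0 n (n≤0⇒n≡0 le)

      private
        x₀∈ : μ removed x₀ ≢ 0
        x₀∈ z with ≡-trans (sym (δ-≡ {x₀} refl)) (m+n≡0⇒m≡0 _ z)
        ... | ()
        x₁∈ : μ removed x₁ ≢ 0
        x₁∈ z with ≡-trans (sym (δ-≡ {x₁} refl)) (m+n≡0⇒m≡0 _ (m+n≡0⇒n≡0 (δ x₀ x₁) z))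
        ... | ()
        x₂∈ : μ removed x₂ ≢ 0
        x₂∈ z with ≡-trans (sym (δ-≡ {x₂} refl)) (m+n≡0⇒m≡0 _ (m+n≡0⇒n≡0 (δ x₁ x₂) (m+n≡0⇒n≡0 (δ x₀ x₂) z)))
        ... | ()

        x₀≢x₁ : x₀ ≢ x₁
        x₀≢x₁ eq with subst₂ (λ i j → i + (j + (δ x₂ x₁ + 0)) + μ rest x₁ ≤ 1) (δ-≡ eq) (δ-≡ {x₁} refl) (once x₁)
        ... | s≤s ()
        x₀≢x₂ : x₀ ≢ x₂
        x₀≢x₂ eq with ≤-trans (m≤n+m _ (δ x₁ x₂)) (≤-pred (subst (λ i → i + (δ x₁ x₂ + (δ x₂ x₂ + 0)) ≤ 1) (δ-≡ eq) (m+n≤o⇒m≤o _ (once x₂))))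
        ... | le with subst (λ i → i + 0 ≤ 0) (δ-≡ {x₂} refl) le
        ... | ()
        x₁≢x₂ : x₁ ≢ x₂
        x₁≢x₂ eq with subst₂ (λ i j → i + (j + 0) ≤ 1) (δ-≡ eq) (δ-≡ {x₂} refl) (m+n≤o⇒n≤o (δ x₀ x₂) (m+n≤o⇒m≤o _ (once x₂)))
        ... | s≤s ()

        kept : ∀ {K T E : List A} {k} → length T ≤ length K + length E → length E ≤ 3 → s ≤ length T → k + 3 ≤ s → k ≤ length K
        kept {K} {T} {E} {k} le E≤3 s≤T k+3≤s = +-cancelʳ-≤ 3 k (length K) (≤-trans k+3≤s (≤-trans s≤T (≤-trans le (+-monoʳ-≤ (length K) E≤3))))

      relay : ∀ E C → length E ≤ 3 → (∀ v → deg C v + 3 ≤ s) → Relay E C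
      relay E C E≤3 room
        with avoiding E T₀ (λ v → m+n≤o⇒m≤o _ (subst (_≤ 1) (μ-++ T₀ (T₁ ++ T₂) v) (rest-distinct v)))
           | avoiding E T₁ (λ v → m+n≤o⇒m≤o _ (subst (_≤ 1) (μ-++ T₁ T₂ v) (m+n≤o⇒n≤o (μ T₀ v) (subst (_≤ 1) (μ-++ T₀ (T₁ ++ T₂) v) (rest-distinct v)))))
           | avoiding E T₂ (λ v → m+n≤o⇒n≤o (μ T₁ v) (subst (_≤ 1) (μ-++ T₁ T₂ v) (m+n≤o⇒n≤o (μ T₀ v) (subst (_≤ 1) (μ-++ T₀ (T₁ ++ T₂) v) (rest-distinct v)))))
      ... | K₀ , X₀ , p₀ , l₀ , f₀ | K₁ , X₁ , p₁ , l₁ , f₁ | K₂ , X₂ , p₂ , l₂ , f₂ = record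
        { K = K₀ ++ K₁ ++ K₂
        ; C' = S₂.D'
        ; route = λ N e → resolve (⊨-resource (reassemble (pairs rest)) (⊨-weaken extra (S₀.route N (S₁.route N (S₂.route N e)))))
        ; K≤rest = K≤rest
        ; avoids = avoids
        ; degree-kept = degree-kept
        ; degree-removed = degree-removed
        }
        where
        open ≤-Reasoning
        μK : ∀ v → μ (K₀ ++ K₁ ++ K₂) v ≡ μ K₀ v + (μ K₁ v + μ K₂ v)
        μK v = ≡-trans (μ-++ K₀ (K₁ ++ K₂) v) (cong (μ K₀ v +_) (μ-++ K₁ K₂ v))
        part : ∀ {T} K X → T ↭ K ++ X → ∀ v → μ K v ≤ μ T v
        part {T} K X p v = ≤-trans (m≤m+n _ (μ X v)) (≤-reflexive (sym (≡-trans (μ-↭ p v) (μ-++ K X v))))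
        K≤rest : ∀ v → μ (K₀ ++ K₁ ++ K₂) v ≤ μ rest v
        K≤rest v = ≤-trans (≤-reflexive (μK v)) (≤-trans (+-mono-≤ (part K₀ X₀ p₀ v) (+-mono-≤ (part K₁ X₁ p₁ v) (part K₂ X₂ p₂ v)))
          (≤-reflexive (sym (≡-trans (μ-++ T₀ (T₁ ++ T₂) v) (cong (μ T₀ v +_) (μ-++ T₁ T₂ v))))))
        K-removed : ∀ v → μ removed v ≢ 0 → μ K₀ v ≡ 0 × μ K₁ v ≡ 0 × μ K₂ v ≡ 0
        K-removed v μ≢0 = m+n≡0⇒m≡0 _ z , m+n≡0⇒m≡0 _ z' , m+n≡0⇒n≡0 (μ K₁ v) z'
          where
          z : μ K₀ v + (μ K₁ v + μ K₂ v) ≡ 0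
          z = n≤0⇒n≡0 (≤-trans (≤-reflexive (sym (μK v))) (≤-trans (K≤rest v) (≤-reflexive (removed∩rest v μ≢0))))
          z' : μ K₁ v + μ K₂ v ≡ 0
          z' = m+n≡0⇒n≡0 (μ K₀ v) z
        avoids : ∀ v → μ E v ≡ 0 ⊎ μ (K₀ ++ K₁ ++ K₂) v ≡ 0
        avoids v with f₀ v | f₁ v | f₂ v
        ... | inj₁ z | _ | _ = inj₁ z
        ... | _ | inj₁ z | _ = inj₁ z
        ... | _ | _ | inj₁ z = inj₁ z
        ... | inj₂ z₀ | inj₂ z₁ | inj₂ z₂ = inj₂ (≡-trans (μK v) (cong₂ _+_ z₀ (cong₂ _+_ z₁ z₂)))
        S₀' : Sent x₀ K₀ C
        S₀' = send x₀ K₀ C (kept {K₀} {T₀} {E} l₀ E≤3 large₀ (room x₀))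
        module S₀ = Sent S₀'
        -- The takers lie outside the removed vertices, so what `x₀` sends away does not burden
        -- `x₁`, and likewise for `x₂` below.
        at₁ : deg S₀.D' x₁ ≤ deg C x₁
        at₁ = ≤-trans (S₀.others x₁ x₀≢x₁) (≤-reflexive (≡-trans (cong (deg C x₁ +_) (proj₁ (K-removed x₁ x₁∈))) (+-identityʳ _)))
        S₁' : Sent x₁ K₁ S₀.D'
        S₁' = send x₁ K₁ S₀.D' (≤-trans at₁ (kept {K₁} {T₁} {E} l₁ E≤3 large₁ (room x₁)))
        module S₁ = Sent S₁'
        at₂ : deg S₁.D' x₂ ≤ deg C x₂
        at₂ = begin
          deg S₁.D' x₂                          ≤⟨ S₁.others x₂ x₁≢x₂ ⟩
          deg S₀.D' x₂ + μ K₁ x₂                ≤⟨ +-monoˡ-≤ (μ K₁ x₂) (S₀.others x₂ x₀≢x₂) ⟩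
          deg C x₂ + μ K₀ x₂ + μ K₁ x₂          ≡⟨ cong₂ (λ i j → deg C x₂ + i + j) (proj₁ (K-removed x₂ x₂∈)) (proj₁ (proj₂ (K-removed x₂ x₂∈))) ⟩
          deg C x₂ + 0 + 0                      ≡⟨ ≡-trans (+-identityʳ _) (+-identityʳ _) ⟩
          deg C x₂                              ∎
        S₂' : Sent x₂ K₂ S₁.D'
        S₂' = send x₂ K₂ S₁.D' (≤-trans at₂ (kept {K₂} {T₂} {E} l₂ E≤3 large₂ (room x₂)))
        module S₂ = Sent S₂'
        degree-kept : ∀ v → μ removed v ≡ 0 → deg S₂.D' v ≤ deg C v + μ (K₀ ++ K₁ ++ K₂) v
        degree-kept v z = begin
          deg S₂.D' v                                   ≤⟨ S₂.others v (distinct z₂) ⟩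
          deg S₁.D' v + μ K₂ v                          ≤⟨ +-monoˡ-≤ (μ K₂ v) (S₁.others v (distinct z₁)) ⟩
          deg S₀.D' v + μ K₁ v + μ K₂ v                 ≤⟨ +-monoˡ-≤ (μ K₂ v) (+-monoˡ-≤ (μ K₁ v) (S₀.others v (distinct z₀))) ⟩
          deg C v + μ K₀ v + μ K₁ v + μ K₂ v            ≡⟨ lemma (deg C v) (μ K₀ v) (μ K₁ v) (μ K₂ v) ⟩
          deg C v + (μ K₀ v + (μ K₁ v + μ K₂ v))        ≡⟨ cong (deg C v +_) (sym (μK v)) ⟩
          deg C v + μ (K₀ ++ K₁ ++ K₂) v                ∎
          where
          lemma : ∀ a b c d → a + b + c + d ≡ a + (b + (c + d))
          lemma = solve-∀
          z₀ : δ x₀ v ≡ 0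
          z₀ = m+n≡0⇒m≡0 _ z
          z₁ : δ x₁ v ≡ 0
          z₁ = m+n≡0⇒m≡0 _ (m+n≡0⇒n≡0 (δ x₀ v) z)
          z₂ : δ x₂ v ≡ 0
          z₂ = m+n≡0⇒m≡0 _ (m+n≡0⇒n≡0 (δ x₁ v) (m+n≡0⇒n≡0 (δ x₀ v) z))
          distinct : ∀ {x} → δ x v ≡ 0 → x ≢ v
          distinct δ≡0 x≡v with ≡-trans (sym (δ-≡ x≡v)) δ≡0
          ... | ()
        at-x₀ : deg S₂.D' x₀ ≤ 0
        at-x₀ = let z₀ , z₁ , z₂ = K-removed x₀ x₀∈ in begin
          deg S₂.D' x₀                          ≤⟨ S₂.others x₀ (x₀≢x₂ ∘ sym) ⟩
          deg S₁.D' x₀ + μ K₂ x₀                ≤⟨ +-monoˡ-≤ (μ K₂ x₀) (S₁.others x₀ (x₀≢x₁ ∘ sym)) ⟩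
          deg S₀.D' x₀ + μ K₁ x₀ + μ K₂ x₀      ≤⟨ +-monoˡ-≤ (μ K₂ x₀) (+-monoˡ-≤ (μ K₁ x₀) S₀.self) ⟩
          μ K₀ x₀ + μ K₁ x₀ + μ K₂ x₀           ≡⟨ cong₂ _+_ (cong₂ _+_ z₀ z₁) z₂ ⟩
          0                                     ∎
        at-x₁ : deg S₂.D' x₁ ≤ 0
        at-x₁ = let z₀ , z₁ , z₂ = K-removed x₁ x₁∈ in begin
          deg S₂.D' x₁                          ≤⟨ S₂.others x₁ (x₁≢x₂ ∘ sym) ⟩
          deg S₁.D' x₁ + μ K₂ x₁                ≤⟨ +-monoˡ-≤ (μ K₂ x₁) S₁.self ⟩
          μ K₁ x₁ + μ K₂ x₁                     ≡⟨ cong₂ _+_ z₁ z₂ ⟩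
          0                                     ∎
        at-x₂ : deg S₂.D' x₂ ≤ 0
        at-x₂ = ≤-trans S₂.self (≤-reflexive (proj₂ (proj₂ (K-removed x₂ x₂∈))))
        degree-removed : ∀ v → μ removed v ≢ 0 → deg S₂.D' v ≡ 0
        degree-removed v μ≢0 = cases (present removed μ≢0)
          where
          cases : v ∈ removed → deg S₂.D' v ≡ 0
          cases (here refl) = n≤0⇒n≡0 at-x₀
          cases (there (here refl)) = n≤0⇒n≡0 at-x₁
          cases (there (there (here refl))) = n≤0⇒n≡0 at-x₂
        extra : List (A × A)
        extra = map (x₀ ,_) X₀ ++ map (x₁ ,_) X₁ ++ map (x₂ ,_) X₂
        slots : ∀ x {T} K X → T ↭ K ++ X → map (x ,_) K ++ map (x ,_) X ↭ map (x ,_) T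
        slots x {T} K X p = ↭-trans (↭-reflexive (sym (map-++ (x ,_) K X))) (↭-sym (↭-map⁺ (x ,_) p))
        reassemble : ∀ P → (map (x₀ ,_) K₀ ++ map (x₁ ,_) K₁ ++ map (x₂ ,_) K₂ ++ P) ++ extra ⇆
                     (map (x₀ ,_) T₀ ++ map (x₁ ,_) T₁ ++ map (x₂ ,_) T₂) ++ P
        reassemble P = ↭⇒⇆ (↭-trans
          (Perm.solve 7 (λ k₀ k₁ k₂ y₀ y₁ y₂ p → ((k₀ ⊕ (k₁ ⊕ (k₂ ⊕ p))) ⊕ (y₀ ⊕ (y₁ ⊕ y₂))) ⊜ (((k₀ ⊕ y₀) ⊕ ((k₁ ⊕ y₁) ⊕ (k₂ ⊕ y₂))) ⊕ p)) refl
            (map (x₀ ,_) K₀) (map (x₁ ,_) K₁) (map (x₂ ,_) K₂) (map (x₀ ,_) X₀) (map (x₁ ,_) X₁) (map (x₂ ,_) X₂) P)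
          (++⁺ʳ P (++⁺ (slots x₀ K₀ X₀ p₀) (++⁺ (slots x₁ K₁ X₁ p₁) (slots x₂ K₂ X₂ p₂)))))
          where open Perm using (_⊕_; _⊜_)

-- The induction on r for complete graphs

module CompleteGraph {A : Set} (_≟_ : DecidableEquality A) where

  open Keyed _≟_ {A} id
  open Konig _≟_ {A} id
  open Complete _≟_
  open Relays _≟_

  private
    hits : ∀ (f : A × A → A) M X → tally (λ e → μ X (f e)) M ≡ tally (λ x → tally (λ e → δ (f e) x) M) X
    hits f [] X = sym (tally-zero (universal (λ _ → refl) X))
    hits f (e ∷ M) X = ≡-trans (cong₂ _+_ (tally-cong (λ x → δ-sym x (f e)) X) (hits f M X))
      (sym (tally-+ (λ x → δ (f e) x) (λ x → tally (λ e → δ (f e) x) M) X))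

    -- Double counting of incidences: each edge of `M` contributes at least one, each entry of `X`
    -- receives at most one.
    hit-length : ∀ (f : A × A → A) M X → (∀ v → tally (λ e → δ (f e) v) M ≤ 1) →
                 All (λ e → μ X (f e) ≢ 0) M → length M ≤ length X
    hit-length f M X le hit = begin
      length M                                            ≡⟨ sym (tally-one (universal (λ _ → refl) M)) ⟩
      tally (λ _ → 1) M                                   ≤⟨ counted M hit ⟩
      tally (λ e → μ X (f e)) M                           ≡⟨ hits f M X ⟩
      tally (λ x → tally (λ e → δ (f e) x) M) X           ≤⟨ tally-mono le X ⟩
      tally (λ _ → 1) X                                   ≡⟨ tally-one (universal (λ _ → refl) X) ⟩
      length X                                            ∎
      where
      open ≤-Reasoning
      counted : ∀ M → All (λ e → μ X (f e) ≢ 0) M → tally (λ _ → 1) M ≤ tally (λ e → μ X (f e)) M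
      counted [] [] = z≤n
      counted (e ∷ M) (h ∷ hs) = +-mono-≤ (n≢0⇒n>0 h) (counted M hs)

    missed : ∀ (f : A × A → A) X M {v} → (∀ e → μ X (f e) ≢ 0 → f e ≢ v) →
             All (λ e → μ X (f e) ≢ 0) M → tally (λ e → δ (f e) v) M ≡ 0
    missed f X [] h [] = refl
    missed f X (e ∷ M) h (p ∷ ps) = cong₂ _+_ (δ-≢ (h e p)) (missed f X M h ps)

    -- Arcs of the second matching, divided by how they meet the removed vertices `X`. The target is
    -- tested first, so an arc with both ends in `X` counts as `into`.
    record Parts (X : List A) (M : List (A × A)) : Set where
      constructor parts
      field
        into from off : List (A × A)
        split : M ↭ into ++ from ++ off
        into-hit : All (λ e → μ X (proj₂ e) ≢ 0) into
        from-hit : All (λ e → μ X (proj₁ e) ≢ 0) from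
        off-src  : All (λ e → μ X (proj₁ e) ≡ 0) off
        off-tgt  : All (λ e → μ X (proj₂ e) ≡ 0) off

    divide : ∀ X M → Parts X M
    divide X [] = parts [] [] [] refl [] [] [] []
    divide X (e ∷ M) with divide X M | μ X (proj₂ e) ≟ℕ 0 | μ X (proj₁ e) ≟ℕ 0
    ... | parts a b c p h h' h₁ h₂ | no t | _ = parts (e ∷ a) b c (prep e p) (t ∷ h) h' h₁ h₂
    ... | parts a b c p h h' h₁ h₂ | yes t | no s = parts a (e ∷ b) c (trans (prep e p) (↭-sym (shift e a (b ++ c)))) h (s ∷ h') h₁ h₂
    ... | parts a b c p h h' h₁ h₂ | yes t | yes s = parts a b (e ∷ c)
            (trans (prep e p) (Perm.solve 4 (λ e a b c → (e ⊕ (a ⊕ (b ⊕ c))) ⊜ (a ⊕ (b ⊕ (e ⊕ c)))) refl [ e ] a b c)) h h' (s ∷ h₁) (t ∷ h₂)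
      where open Perm using (_⊕_; _⊜_)

    exclusive : ∀ {m n} → m ≤ 1 → n ≤ 1 → m ≡ 0 ⊎ n ≡ 0 → m + n ≤ 1
    exclusive m≤1 n≤1 (inj₁ refl) = n≤1
    exclusive {m} m≤1 n≤1 (inj₂ refl) = subst (_≤ 1) (sym (+-identityʳ m)) m≤1

    below : ∀ {x} y z → x ≡ y + z → x ≡ 0 → y ≡ 0 × z ≡ 0
    below y z eq refl = m+n≡0⇒m≡0 y (sym eq) , m+n≡0⇒n≡0 y (sym eq)

    -- In the first round M₁ is routed through X₁.  The arcs of M₂ that meet X₁ cannot be routed through X₂ in the second
    -- round; to make up for this, the sources of those into X₁ receive no demand in the first round, and the targets of
    -- those from X₁ receive none in the second.
    module Step (ρ : ℕ) (V : List A) (D M₁ M₂ Dr : List (A × A)) (V-distinct : Distinct V)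
                (V-large : 6 * (2 + ρ) + 12 ≤ length V) (D-on : On V D)
                (mat₁ : Matching M₁) (mat₂ : Matching M₂) (Dr≤ : ∀ v → deg Dr v ≤ 2 * ρ)
                (D⇆ : D ⇆ M₁ ++ M₂ ++ Dr)
                (solve : ∀ V' D' → Distinct V' → 6 * (1 + ρ) + 12 ≤ length V' → On V' D' →
                         (∀ v → deg D' v ≤ 2 * (1 + ρ)) → pairs V' ⊨ D') where

      open ≤-Reasoning

      -- `k` bounds the degrees of the demands that are passed on in either round; 3 is the number
      -- of vertices that a round may bar.
      k s : ℕ
      k = 2 * ρ + 2
      s = k + 3

      deg-D : ∀ v → deg D v ≡ deg M₁ v + (deg M₂ v + deg Dr v)
      deg-D v = ≡-trans (deg-⇆ D⇆ v) (≡-trans (deg-++ M₁ (M₂ ++ Dr) v) (cong (deg M₁ v +_) (deg-++ M₂ Dr v)))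

      abstract
        st₁ : Stage V M₁ s
        st₁ = makeStage V M₁ s mat₁ (λ v z → proj₁ (below (deg M₁ v) _ (deg-D v) (D-on v z)))
          (≤-trans (m≤m+n _ 4) (≤-trans (≤-reflexive (lemma ρ)) V-large))
          where lemma : ∀ ρ → 3 * (2 * ρ + 2 + 3) + 5 + 4 ≡ 6 * (2 + ρ) + 12
                lemma = solve-∀

      module S₁ = Stage st₁

      X₁ : List A
      X₁ = removed st₁

      abstract
        parts₁ : Parts X₁ M₂
        parts₁ = divide X₁ M₂

      open Parts parts₁

      deg-M₂ : ∀ v → out into v + (out from v + out off v) ≡ out M₂ v
      deg-M₂ v = ≡-trans (sym (≡-trans (out-++ into (from ++ off) v) (cong (out into v +_) (out-++ from off v)))) (sym (tally-↭ _ split))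

      inn-M₂ : ∀ v → inn into v + (inn from v + inn off v) ≡ inn M₂ v
      inn-M₂ v = ≡-trans (sym (≡-trans (inn-++ into (from ++ off) v) (cong (inn into v +_) (inn-++ from off v)))) (sym (tally-↭ _ split))

      outs : ∀ v → out into v + (out from v + out off v) ≤ 1
      outs v = ≤-trans (≤-reflexive (deg-M₂ v)) (proj₁ mat₂ v)

      inns : ∀ v → inn into v + (inn from v + inn off v) ≤ 1
      inns v = ≤-trans (≤-reflexive (inn-M₂ v)) (proj₂ mat₂ v)

      into-inn : ∀ v → μ X₁ v ≡ 0 → inn into v ≡ 0
      into-inn v z = missed proj₂ X₁ into (λ e h eq → h (subst (λ w → μ X₁ w ≡ 0) (sym eq) z)) into-hit

      from-out : ∀ v → μ X₁ v ≡ 0 → out from v ≡ 0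
      from-out v z = missed proj₁ X₁ from (λ e h eq → h (subst (λ w → μ X₁ w ≡ 0) (sym eq) z)) from-hit

      off-deg : ∀ v → μ X₁ v ≢ 0 → deg off v ≡ 0
      off-deg v μ≢0 = cong₂ _+_
        (tally-zero (mapAll (λ h → δ-≢ (λ eq → μ≢0 (subst (λ w → μ X₁ w ≡ 0) eq h))) off-src))
        (tally-zero (mapAll (λ h → δ-≢ (λ eq → μ≢0 (subst (λ w → μ X₁ w ≡ 0) eq h))) off-tgt))

      -- `off` is set aside for the second round, while `into` and `from` are demoted to ordinary
      -- demands.
      C : List (A × A)
      C = into ++ from ++ Dr

      deg-C : ∀ v → deg C v ≡ deg into v + (deg from v + deg Dr v)
      deg-C v = ≡-trans (deg-++ into (from ++ Dr) v) (cong (deg into v +_) (deg-++ from Dr v))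

      room₁ : ∀ v → deg C v + 3 ≤ s
      room₁ v = +-monoˡ-≤ 3 (begin
        deg C v                                                                   ≡⟨ deg-C v ⟩
        out into v + inn into v + (out from v + inn from v + deg Dr v)            ≡⟨ lemma (out into v) (inn into v) (out from v) (inn from v) (deg Dr v) ⟩
        deg Dr v + ((out into v + out from v) + (inn into v + inn from v))        ≤⟨ +-mono-≤ (Dr≤ v) (+-mono-≤
            (≤-trans (+-monoʳ-≤ (out into v) (m≤m+n _ (out off v))) (outs v))
            (≤-trans (+-monoʳ-≤ (inn into v) (m≤m+n _ (inn off v))) (inns v))) ⟩
        2 * ρ + 2                                                                 ∎)
        where
        lemma : ∀ a b c d e → a + b + (c + d + e) ≡ e + ((a + c) + (b + d))
        lemma = solve-∀

      abstract
        rel₁ : Relay st₁ (map proj₁ into) C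
        rel₁ = relay st₁ V-distinct (map proj₁ into) C
          -- The targets of `into` are distinct and lie among three vertices, so at most three
          -- sources are barred.
          (≤-trans (≤-reflexive (length-map proj₁ into)) (hit-length proj₂ into X₁ (λ v → m+n≤o⇒m≤o _ (inns v)) into-hit)) room₁

      module R₁ = Relay rel₁

      slot₁ : ∀ v → out into v + μ R₁.K v ≤ 1
      slot₁ v = exclusive (m+n≤o⇒m≤o _ (outs v)) (≤-trans (R₁.K≤rest v) (rest-distinct st₁ V-distinct v))
        (avoid (R₁.avoids v))
        where
        avoid : μ (map proj₁ into) v ≡ 0 ⊎ μ R₁.K v ≡ 0 → out into v ≡ 0 ⊎ μ R₁.K v ≡ 0
        avoid (inj₁ z) = inj₁ (≡-trans (sym (tally-map _ proj₁ into)) z)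
        avoid (inj₂ z) = inj₂ z

      from-inn : ∀ v → inn from v ≤ 1
      from-inn v = m+n≤o⇒m≤o _ (m+n≤o⇒n≤o (inn into v) (inns v))

      -- `X₁` passes on its own end of an `into` or `from` arc, but the far end still counts: a
      -- source for `into`, a target for `from`. These are the extra terms that the barred vertices
      -- compensate.
      kept₁ : ∀ v → μ X₁ v ≡ 0 → deg R₁.C' v ≤ (out into v + μ R₁.K v) + inn from v + deg Dr v
      kept₁ v z = begin
        deg R₁.C' v                                                               ≤⟨ R₁.degree-kept v z ⟩
        deg C v + μ R₁.K v                                                        ≡⟨ cong (_+ μ R₁.K v) (deg-C v) ⟩
        out into v + inn into v + (out from v + inn from v + deg Dr v) + μ R₁.K v ≡⟨ cong₂ (λ i j → out into v + i + (j + inn from v + deg Dr v) + μ R₁.K v) (into-inn v z) (from-out v z) ⟩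
        out into v + 0 + (0 + inn from v + deg Dr v) + μ R₁.K v                   ≡⟨ lemma (out into v) (inn from v) (deg Dr v) (μ R₁.K v) ⟩
        (out into v + μ R₁.K v) + inn from v + deg Dr v                           ∎
        where
        lemma : ∀ a b c d → a + 0 + (0 + b + c) + d ≡ (a + d) + b + c
        lemma = solve-∀

      bound₁ : ∀ v → Dec (μ X₁ v ≡ 0) → deg R₁.C' v ≤ k
      bound₁ v (yes z) = ≤-trans (kept₁ v z) (≤-trans (+-mono-≤ (+-mono-≤ (slot₁ v) (from-inn v)) (Dr≤ v)) (≤-reflexive (+-comm 2 (2 * ρ))))
      bound₁ v (no μ≢0) = ≤-trans (≤-reflexive (R₁.degree-removed v μ≢0)) z≤n

      gone₁ : ∀ v → μ S₁.rest v ≡ 0 → μ X₁ v ≡ 0 → deg M₂ v ≡ 0 × deg Dr v ≡ 0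
      gone₁ v z z' = below (deg M₂ v) (deg Dr v) refl (proj₂ (below (deg M₁ v) _ (deg-D v) (D-on v (≡-trans (μ-cover st₁ v) (cong₂ _+_ z' z)))))

      off-on : On S₁.rest off
      off-on v z = decide (μ X₁ v ≟ℕ 0)
        where
        decide : Dec (μ X₁ v ≡ 0) → deg off v ≡ 0
        decide (no μ≢0) = off-deg v μ≢0
        decide (yes z') = let o , i = below (out M₂ v) (inn M₂ v) refl (proj₁ (gone₁ v z z')) in cong₂ _+_
          (proj₂ (below (out from v) (out off v) refl (proj₂ (below (out into v) _ (sym (deg-M₂ v)) o))))
          (proj₂ (below (inn from v) (inn off v) refl (proj₂ (below (inn into v) _ (sym (inn-M₂ v)) i))))

      large₁ : length V ≡ 3 + length S₁.rest
      large₁ = ↭-length S₁.cover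

      abstract
        st₂ : Stage S₁.rest off s
        st₂ = makeStage S₁.rest off s
          ((λ v → m+n≤o⇒n≤o (out from v) (m+n≤o⇒n≤o (out into v) (outs v))) ,
           (λ v → m+n≤o⇒n≤o (inn from v) (m+n≤o⇒n≤o (inn into v) (inns v)))) off-on
          (+-cancelˡ-≤ 3 _ _ (≤-trans (m≤m+n _ 1) (≤-trans (≤-reflexive (lemma ρ)) (≤-trans V-large (≤-reflexive large₁)))))
          where lemma : ∀ ρ → 3 + (3 * (2 * ρ + 2 + 3) + 5) + 1 ≡ 6 * (2 + ρ) + 12
                lemma = solve-∀

      module S₂ = Stage st₂

      X₂ : List A
      X₂ = removed st₂

      rest₁-distinct : Distinct S₁.rest
      rest₁-distinct = rest-distinct st₁ V-distinct

      abstract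
        rel₂ : Relay st₂ (map proj₂ from) R₁.C'
        rel₂ = relay st₂ rest₁-distinct (map proj₂ from) R₁.C'
          (≤-trans (≤-reflexive (length-map proj₂ from)) (hit-length proj₁ from X₁
            (λ v → m+n≤o⇒m≤o _ (m+n≤o⇒n≤o (out into v) (outs v))) from-hit))
          (λ v → +-monoˡ-≤ 3 (bound₁ v (μ X₁ v ≟ℕ 0)))

      module R₂ = Relay rel₂

      slot₂ : ∀ v → inn from v + μ R₂.K v ≤ 1
      slot₂ v = exclusive (from-inn v) (≤-trans (R₂.K≤rest v) (rest-distinct st₂ rest₁-distinct v)) (avoid (R₂.avoids v))
        where
        avoid : μ (map proj₂ from) v ≡ 0 ⊎ μ R₂.K v ≡ 0 → inn from v ≡ 0 ⊎ μ R₂.K v ≡ 0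
        avoid (inj₁ z) = inj₁ (≡-trans (sym (tally-map _ proj₂ from)) z)
        avoid (inj₂ z) = inj₂ z

      -- At a vertex that was never removed, an outgoing `into` arc and the first relay together
      -- cost at most one unit, and so do an incoming `from` arc and the second relay. With `Dr`
      -- this makes at most 2ρ + 2.
      bound₂ : ∀ v → Dec (μ X₂ v ≡ 0) → Dec (μ X₁ v ≡ 0) → deg R₂.C' v ≤ 2 * (1 + ρ)
      bound₂ v (no μ≢0) _ = ≤-trans (≤-reflexive (R₂.degree-removed v μ≢0)) z≤n
      bound₂ v (yes z) (no μ≢0) = begin
        deg R₂.C' v                ≤⟨ R₂.degree-kept v z ⟩
        deg R₁.C' v + μ R₂.K v     ≡⟨ cong (_+ μ R₂.K v) (R₁.degree-removed v μ≢0) ⟩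
        μ R₂.K v                   ≤⟨ m+n≤o⇒n≤o (inn from v) (slot₂ v) ⟩
        1                          ≤⟨ s≤s z≤n ⟩
        2 + 2 * ρ                  ≡⟨ sym (*-suc 2 ρ) ⟩
        2 * (1 + ρ)                ∎
      bound₂ v (yes z) (yes z') = begin
        deg R₂.C' v                                                        ≤⟨ R₂.degree-kept v z ⟩
        deg R₁.C' v + μ R₂.K v                                             ≤⟨ +-monoˡ-≤ (μ R₂.K v) (kept₁ v z') ⟩
        (out into v + μ R₁.K v) + inn from v + deg Dr v + μ R₂.K v         ≡⟨ lemma (out into v + μ R₁.K v) (inn from v) (deg Dr v) (μ R₂.K v) ⟩
        (out into v + μ R₁.K v) + (inn from v + μ R₂.K v) + deg Dr v       ≤⟨ +-mono-≤ (+-mono-≤ (slot₁ v) (slot₂ v)) (Dr≤ v) ⟩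
        2 + 2 * ρ                                                          ≡⟨ sym (*-suc 2 ρ) ⟩
        2 * (1 + ρ)                                                        ∎
        where
        lemma : ∀ a b c d → a + b + c + d ≡ a + (b + d) + c
        lemma = solve-∀

      C'-on : On S₂.rest R₂.C'
      C'-on v z = decide (μ X₂ v ≟ℕ 0) (μ X₁ v ≟ℕ 0)
        where
        absent : ∀ {K W} → μ K v ≤ μ W v → μ W v ≡ 0 → μ K v ≡ 0
        absent le w = n≤0⇒n≡0 (≤-trans le (≤-reflexive w))
        decide : Dec (μ X₂ v ≡ 0) → Dec (μ X₁ v ≡ 0) → deg R₂.C' v ≡ 0
        decide (no μ≢0) _ = R₂.degree-removed v μ≢0
        decide (yes z₂) (no μ≢0) = n≤0⇒n≡0 (≤-trans (R₂.degree-kept v z₂) (≤-reflexive (cong₂ _+_ (R₁.degree-removed v μ≢0) (absent {R₂.K} {S₂.rest} (R₂.K≤rest v) z))))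
        decide (yes z₂) (yes z₁) = n≤0⇒n≡0 (≤-trans (R₂.degree-kept v z₂) (≤-reflexive (cong₂ _+_
            (n≤0⇒n≡0 (≤-trans (R₁.degree-kept v z₁) (≤-reflexive (cong₂ _+_ C≡0 (absent {R₁.K} {S₁.rest} (R₁.K≤rest v) z')))))
            (absent {R₂.K} {S₂.rest} (R₂.K≤rest v) z))))
          where
          z' : μ S₁.rest v ≡ 0
          z' = ≡-trans (μ-cover st₂ v) (cong₂ _+_ z₂ z)
          M₂≡0 : out M₂ v ≡ 0 × inn M₂ v ≡ 0
          M₂≡0 = below (out M₂ v) (inn M₂ v) refl (proj₁ (gone₁ v z' z₁))
          os : out into v ≡ 0 × out from v + out off v ≡ 0
          os = below (out into v) _ (sym (deg-M₂ v)) (proj₁ M₂≡0)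
          is : inn into v ≡ 0 × inn from v + inn off v ≡ 0
          is = below (inn into v) _ (sym (inn-M₂ v)) (proj₂ M₂≡0)
          C≡0 : deg C v ≡ 0
          C≡0 = ≡-trans (deg-C v) (cong₂ _+_ (cong₂ _+_ (proj₁ os) (proj₁ is))
            (cong₂ _+_ (cong₂ _+_ (m+n≡0⇒m≡0 (out from v) (proj₂ os)) (m+n≡0⇒m≡0 (inn from v) (proj₂ is))) (proj₂ (gone₁ v z' z₁))))

      solution : pairs V ⊨ D
      solution = ⊨-perm (⇆-sym (⇆-trans D⇆ (↭⇒⇆ (++⁺ˡ M₁ (↭-trans (++⁺ʳ Dr split)
          (Perm.solve 4 (λ a b c d → ((a ⊕ (b ⊕ c)) ⊕ d) ⊜ (c ⊕ (a ⊕ (b ⊕ d)))) refl into from off Dr))))))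
        (R₁.route off (R₂.route [] (solve S₂.rest R₂.C' (rest-distinct st₂ rest₁-distinct) large₂ C'-on
          (λ v → bound₂ v (μ X₂ v ≟ℕ 0) (μ X₁ v ≟ℕ 0)))))
        where
        open Perm using (_⊕_; _⊜_)
        large₂ : 6 * (1 + ρ) + 12 ≤ length S₂.rest
        large₂ = +-cancelˡ-≤ 6 _ _ (≤-trans (≤-reflexive (lemma ρ)) (≤-trans V-large (≤-reflexive (≡-trans large₁ (cong (3 +_) (↭-length S₂.cover))))))
          where lemma : ∀ ρ → 6 + (6 * (1 + ρ) + 12) ≡ 6 * (2 + ρ) + 12
                lemma = solve-∀

  completeGraph : ∀ r V D → Distinct V → 6 * r + 12 ≤ length V → On V D → (∀ v → deg D v ≤ 2 * r) → pairs V ⊨ D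
  completeGraph r V D V-distinct le D-on D≤ with factorization r D D≤
  completeGraph zero V D V-distinct le D-on D≤ | [] , _ , _ , p = ⊨-perm (⇆-sym p) ⊨-[]
  -- With a single matching no demand is left to be passed on, so classes of free vertices of size
  -- `s = 0` suffice.
  completeGraph (suc zero) V D V-distinct le D-on D≤ | M ∷ [] , _ , mat ∷ [] , p =
    ⊨-perm (⇆-sym p) (Stage.resolve (makeStage V M 0 mat M-on (≤-trans (m≤m+n 5 13) le)) ⊨-[])
    where
    M-on : On V M
    M-on v z = proj₁ (below (deg M v) 0 (≡-trans (deg-⇆ p v) (deg-++ M [] v)) (D-on v z))
  completeGraph (suc (suc ρ)) V D V-distinct le D-on D≤ | M₁ ∷ M₂ ∷ Ms , len , mat₁ ∷ mat₂ ∷ mat , p =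
    Step.solution ρ V D M₁ M₂ (concat Ms) V-distinct le D-on mat₁ mat₂
      (subst (λ l → ∀ v → deg (concat Ms) v ≤ 2 * l) (suc-injective (suc-injective len)) (deg-matchings Ms mat)) p
      (completeGraph (suc ρ))

-- Grids

tally-swap : ∀ {A B : Set} (f : A → B → ℕ) xs ys →
             tally (λ x → tally (f x) ys) xs ≡ tally (λ y → tally (λ x → f x y) xs) ys
tally-swap f [] ys = sym (tally-zero (universal (λ _ → refl) ys))
tally-swap f (x ∷ xs) ys = ≡-trans (cong (tally (f x) ys +_) (tally-swap f xs ys)) (sym (tally-+ (f x) _ ys))

tally-* : ∀ {A : Set} k (f : A → ℕ) xs → tally (λ x → k * f x) xs ≡ k * tally f xs
tally-* k f [] = sym (*-zeroʳ k)
tally-* k f (x ∷ xs) = ≡-trans (cong (k * f x +_) (tally-* k f xs)) (sym (*-distribˡ-+ k (f x) (tally f xs)))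

tally-allFin : ∀ n (g : Fin (suc n) → ℕ) → tally g (allFin (suc n)) ≡ g zero + tally (g ∘ Fin.suc) (allFin n)
tally-allFin n g = cong (g zero +_)
  (≡-trans (cong (tally g) (sym (map-tabulate {n = n} id Fin.suc))) (tally-map g Fin.suc (allFin n)))

tally-tabulate : ∀ {A : Set} n (f : A → ℕ) (F : Fin n → List A) →
                 tally f (concat (tabulate F)) ≡ tally (λ c → tally f (F c)) (allFin n)
tally-tabulate zero f F = refl
tally-tabulate (suc n) f F = ≡-trans (tally-++ f (F zero) _)
  (≡-trans (cong (tally f (F zero) +_) (tally-tabulate n f (F ∘ Fin.suc))) (sym (tally-allFin n (λ c → tally f (F c)))))

⊨-concat : ∀ {A K : Set} {F G : K → List (A × A)} → (∀ k → F k ⊨ G k) → ∀ ks → concatMap F ks ⊨ concatMap G ks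
⊨-concat h [] = ⊨-[]
⊨-concat h (k ∷ ks) = ⊨-++ (h k) (⊨-concat h ks)

⊨-tabulate : ∀ {A : Set} n {F G : Fin n → List (A × A)} → (∀ k → F k ⊨ G k) → concat (tabulate F) ⊨ concat (tabulate G)
⊨-tabulate zero h = ⊨-[]
⊨-tabulate (suc n) h = ⊨-++ (h zero) (⊨-tabulate n (h ∘ suc))

module Grid (t : ℕ) where

  module F where
    open Keyed (_≟F_ {t}) id public
    open Complete (_≟F_ {t}) public
    open CompleteGraph (_≟F_ {t}) public

  module V (d : ℕ) where
    open Keyed (_≟V_ {t} {d}) id public
    open Complete (_≟V_ {t} {d}) public using (μ)

  -- Reading demands through `tail` contracts the lines without forgetting the true ends. A demand
  -- inside one line becomes a loop and is assigned to a layer like any other.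
  module T (d : ℕ) where
    open Keyed (_≟V_ {t} {d}) {Vertex t (suc d)} tail public
    open Konig (_≟V_ {t} {d}) {Vertex t (suc d)} tail public

  δ-∷ : ∀ {d} (a b : Fin t) (x y : Vertex t d) → V.δ (suc d) (a ∷ x) (b ∷ y) ≡ V.δ d x y * F.δ a b
  δ-∷ {d} a b x y = decide (a ≟F b) (x ≟V y)
    where
    decide : Dec (a ≡ b) → Dec (x ≡ y) → V.δ (suc d) (a ∷ x) (b ∷ y) ≡ V.δ d x y * F.δ a b
    decide (yes refl) (yes refl) = ≡-trans (V.δ-≡ (suc d) refl) (sym (cong₂ _*_ (V.δ-≡ d {x} refl) (F.δ-≡ {a} refl)))
    decide (no a≢b) _ = ≡-trans (V.δ-≢ (suc d) (a≢b ∘ ∷-injectiveˡ)) (sym (≡-trans (cong (V.δ d x y *_) (F.δ-≢ a≢b)) (*-zeroʳ (V.δ d x y))))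
    decide _ (no x≢y) = ≡-trans (V.δ-≢ (suc d) (x≢y ∘ ∷-injectiveʳ)) (sym (cong (_* F.δ a b) (V.δ-≢ d x≢y)))

  δ-head-tail : ∀ {d} (u : Vertex t (suc d)) b y → V.δ (suc d) u (b ∷ y) ≡ V.δ d (tail u) y * F.δ (head u) b
  δ-head-tail (a ∷ x) b y = δ-∷ a b x y

  μ-allFin : ∀ v → F.μ (allFin t) v ≡ 1
  μ-allFin = once t _≟F_
    where
    once : ∀ n (_≟_ : DecidableEquality (Fin n)) v → Complete.μ _≟_ (allFin n) v ≡ 1
    once (suc n) _≟_ zero = ≡-trans (tally-allFin n (λ w → Indicator.δ _≟_ w zero))
      (cong₂ _+_ (Indicator.δ-≡ _≟_ refl) (tally-zero (universal (λ i → Indicator.δ-≢ _≟_ {Fin.suc i} λ ()) (allFin n))))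
    once (suc n) _≟_ (suc v) = ≡-trans (tally-allFin n (λ w → Indicator.δ _≟_ w (Fin.suc v)))
      (cong₂ _+_ (Indicator.δ-≢ _≟_ {zero} λ ()) (≡-trans (tally-cong same-δ (allFin n)) (once n _≟F_ v)))
      where
      same-δ : ∀ w → Indicator.δ _≟_ (Fin.suc w) (Fin.suc v) ≡ Indicator.δ _≟F_ w v
      same-δ w = decide (w ≟F v)
        where
        decide : Dec (w ≡ v) → Indicator.δ _≟_ (Fin.suc w) (Fin.suc v) ≡ Indicator.δ _≟F_ w v
        decide (yes p) = ≡-trans (Indicator.δ-≡ _≟_ (cong Fin.suc p)) (sym (Indicator.δ-≡ _≟F_ p))
        decide (no ¬p) = ≡-trans (Indicator.δ-≢ _≟_ (¬p ∘ F-suc-injective)) (sym (Indicator.δ-≢ _≟F_ ¬p))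

  allVertices : ∀ d → List (Vertex t d)
  allVertices zero = [ [] ]
  allVertices (suc d) = concat (tabulate λ c → map (c ∷_) (allVertices d))

  μ-allVertices : ∀ d v → V.μ d (allVertices d) v ≡ 1
  μ-allVertices zero [] = refl
  μ-allVertices (suc d) (b ∷ y) = begin
    V.μ (suc d) (allVertices (suc d)) (b ∷ y)                                       ≡⟨ tally-tabulate t _ (λ c → map (c ∷_) (allVertices d)) ⟩
    tally (λ c → V.μ (suc d) (map (c ∷_) (allVertices d)) (b ∷ y)) (allFin t)       ≡⟨ tally-cong (λ c → ≡-trans (tally-map _ (c ∷_) (allVertices d)) (layer c)) (allFin t) ⟩
    tally (λ c → F.δ c b) (allFin t)                                                ≡⟨ μ-allFin b ⟩
    1                                                                               ∎
    where
    open ≡-Reasoning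
    layer : ∀ c → tally (λ x → V.δ (suc d) (c ∷ x) (b ∷ y)) (allVertices d) ≡ F.δ c b
    layer c = begin
      tally (λ x → V.δ (suc d) (c ∷ x) (b ∷ y)) (allVertices d)     ≡⟨ tally-cong (λ x → ≡-trans (δ-∷ c b x y) (*-comm (V.δ d x y) (F.δ c b))) (allVertices d) ⟩
      tally (λ x → F.δ c b * V.δ d x y) (allVertices d)             ≡⟨ tally-* (F.δ c b) _ (allVertices d) ⟩
      F.δ c b * V.μ d (allVertices d) y                             ≡⟨ cong (F.δ c b *_) (μ-allVertices d y) ⟩
      F.δ c b * 1                                                   ≡⟨ *-identityʳ _ ⟩
      F.δ c b                                                       ∎

  within : ∀ {d} → Vertex t d → List (Fin t × Fin t) → List (Vertex t (suc d) × Vertex t (suc d))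
  within x = map (bimap (_∷ x) (_∷ x))

  copy : ∀ {d} → Fin t → List (Vertex t d × Vertex t d) → List (Vertex t (suc d) × Vertex t (suc d))
  copy c = map (bimap (c ∷_) (c ∷_))

  grid : ∀ d → List (Vertex t d × Vertex t d)
  grid zero = []
  grid (suc d) = concatMap (λ x → within x (F.pairs (allFin t))) (allVertices d) ++ concat (tabulate λ c → copy c (grid d))

  -- A demand inside the line over the given vertex, between two values of the first coordinate.
  Step : ℕ → Set
  Step d = Vertex t d × (Fin t × Fin t)

  line : ∀ {d} → Vertex t d → List (Step d) → List (Fin t × Fin t)
  line x [] = []
  line x ((y , e) ∷ S) with y ≟V x
  ... | yes _ = e ∷ line x S
  ... | no _ = line x S

  place : ∀ {d} → Step d → Vertex t (suc d) × Vertex t (suc d)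
  place (x , (a , c)) = a ∷ x , c ∷ x

  line-deg : ∀ {d} (x : Vertex t d) S v →
             F.deg (line x S) v ≡ tally (λ (y , (a , c)) → V.δ d y x * (F.δ a v + F.δ c v)) S
  line-deg x [] v = refl
  line-deg {d} x ((y , (a , c)) ∷ S) v with y ≟V x
  ... | yes y≡x = ≡-trans (F.deg-∷ a c (line x S) v) (cong₂ _+_ (sym (+-identityʳ _)) (line-deg x S v))
  ... | no y≢x = line-deg x S v

  -- Every vertex occurs exactly once in `allVertices`, so sorting the steps by lines neither loses
  -- nor repeats one.
  sort-lines : ∀ {d} (S : List (Step d)) → concatMap (λ x → within x (line x S)) (allVertices d) ↭ map place S
  sort-lines {d} [] = ↭-reflexive (empty (allVertices d))
    where
    empty : ∀ (W : List (Vertex t d)) → concatMap (λ x → within x []) W ≡ []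
    empty [] = refl
    empty (x ∷ W) = empty W
  sort-lines {d} ((y , e) ∷ S) = ↭-trans (insert (allVertices d))
    (subst (λ n → replicate n (place (y , e)) ++ lines ↭ map place ((y , e) ∷ S)) (sym (μ-allVertices d y)) (prep _ (sort-lines S)))
    where
    lines : List (Vertex t (suc d) × Vertex t (suc d))
    lines = concatMap (λ x → within x (line x S)) (allVertices d)
    insert : ∀ W → concatMap (λ x → within x (line x ((y , e) ∷ S))) W ↭
             replicate (V.μ d W y) (place (y , e)) ++ concatMap (λ x → within x (line x S)) W
    insert [] = refl
    insert (x ∷ W) = decide (y ≟V x)
      where
      decide : Dec (y ≡ x) → concatMap (λ x → within x (line x ((y , e) ∷ S))) (x ∷ W) ↭
             replicate (V.μ d (x ∷ W) y) (place (y , e)) ++ concatMap (λ x → within x (line x S)) (x ∷ W)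
      decide (yes refl) with y ≟V y
      ... | no y≢y = ⊥-elim (y≢y refl)
      ... | yes _ = prep _ (↭-trans (++⁺ˡ (within y (line y S)) (insert W))
        (Perm.solve 3 (λ a b c → (a ⊕ (b ⊕ c)) ⊜ (b ⊕ (a ⊕ c))) refl (within y (line y S)) (replicate (V.μ d W y) (place (y , e))) _))
        where open Perm using (_⊕_; _⊜_)
      decide (no y≢x) rewrite V.δ-≢ d {x} {y} (y≢x ∘ sym) with y ≟V x
      ... | yes y≡x = ⊥-elim (y≢x y≡x)
      ... | no _ = ↭-trans (++⁺ˡ (within x (line x S)) (insert W))
        (Perm.solve 3 (λ a b c → (a ⊕ (b ⊕ c)) ⊜ (b ⊕ (a ⊕ c))) refl (within x (line x S)) (replicate (V.μ d W y) (place (y , e))) _)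
        where open Perm using (_⊕_; _⊜_)

-- Routing in grids by induction on the dimension

module GridRouting (t : ℕ) where

  open Grid t

  private
    module _ (d : ℕ) where

      Demands : Set
      Demands = List (Vertex t (suc d) × Vertex t (suc d))

      δ-tail : ∀ (u : Vertex t (suc d)) x → V.δ d (tail u) x ≡ tally (λ a → V.δ (suc d) u (a ∷ x)) (allFin t)
      δ-tail u x = sym (begin
        tally (λ a → V.δ (suc d) u (a ∷ x)) (allFin t)              ≡⟨ tally-cong (λ a → ≡-trans (δ-head-tail u a x) (cong (V.δ d (tail u) x *_) (F.δ-sym (head u) a))) (allFin t) ⟩
        tally (λ a → V.δ d (tail u) x * F.δ a (head u)) (allFin t)  ≡⟨ tally-* (V.δ d (tail u) x) (λ a → F.δ a (head u)) (allFin t) ⟩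
        V.δ d (tail u) x * F.μ (allFin t) (head u)                  ≡⟨ cong (V.δ d (tail u) x *_) (μ-allFin (head u)) ⟩
        V.δ d (tail u) x * 1                                        ≡⟨ *-identityʳ _ ⟩
        V.δ d (tail u) x                                            ∎)
        where open ≡-Reasoning

      end-tail : ∀ (f : Vertex t (suc d) × Vertex t (suc d) → Vertex t (suc d)) (D : Demands) x →
                 tally (λ e → V.δ d (tail (f e)) x) D ≡ tally (λ a → tally (λ e → V.δ (suc d) (f e) (a ∷ x)) D) (allFin t)
      end-tail f D x = ≡-trans (tally-cong (λ e → δ-tail (f e) x) D) (tally-swap (λ e a → V.δ (suc d) (f e) (a ∷ x)) D (allFin t))

      line-degree : ∀ k (D : Demands) → (∀ v → V.deg (suc d) D v ≤ k) → ∀ x → T.deg d D x ≤ t * k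
      line-degree k D le x = begin
        T.deg d D x                                                            ≡⟨ cong₂ _+_ (end-tail proj₁ D x) (end-tail proj₂ D x) ⟩
        tally (λ a → V.out (suc d) D (a ∷ x)) (allFin t) + tally (λ a → V.inn (suc d) D (a ∷ x)) (allFin t)
                                                                               ≡⟨ sym (tally-+ _ _ (allFin t)) ⟩
        tally (λ a → V.deg (suc d) D (a ∷ x)) (allFin t)                       ≤⟨ tally-mono (λ a → ≤-trans (le (a ∷ x)) (≤-reflexive (sym (*-identityʳ k)))) (allFin t) ⟩
        tally (λ a → k * 1) (allFin t)                                         ≡⟨ tally-* k (λ _ → 1) (allFin t) ⟩
        k * tally (λ _ → 1) (allFin t)                                         ≡⟨ cong (k *_) (≡-trans (tally-one (universal (λ _ → refl) (allFin t))) (length-tabulate {n = t} id)) ⟩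
        k * t                                                                  ≡⟨ *-comm k t ⟩
        t * k                                                                  ∎
        where open ≤-Reasoning

      cut : ∀ {X : Set} p {m} (xs : List X) → length xs ≡ p + m → ∃₂ λ ys zs → xs ≡ ys ++ zs × length ys ≡ p × length zs ≡ m
      cut zero xs eq = [] , xs , refl , refl , eq
      cut (suc p) (x ∷ xs) eq with cut p xs (suc-injective eq)
      ... | ys , zs , refl , l , l' = x ∷ ys , zs , refl , cong suc l , l'

      -- The matchings are dealt out in blocks of `p`, and each matching adds at most 2 to a degree.
      group : ∀ n p Ms → length Ms ≡ n * p → All (T.Matching d) Ms →
              ∃ λ (G : Fin n → Demands) → concat Ms ≡ concat (tabulate G) × (∀ c x → T.deg d (G c) x ≤ 2 * p)
      group zero p [] eq [] = (λ ()) , refl , λ ()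
      group (suc n) p Ms eq mat with cut p Ms eq
      ... | Ls , Ns , refl , l , l' with group n p Ns l' (All.++⁻ʳ Ls mat)
      ... | G , q , le = G' , ≡-trans (sym (concat-++ Ls Ns)) (cong (concat Ls ++_) q) , le'
        where
        G' : Fin (suc n) → Demands
        G' zero = concat Ls
        G' (suc c) = G c
        le' : ∀ c x → T.deg d (G' c) x ≤ 2 * p
        le' zero x = subst (λ l → T.deg d (concat Ls) x ≤ 2 * l) l (T.deg-matchings d Ls (All.++⁻ˡ Ls mat) x)
        le' (suc c) x = le c x

      Layered : Set
      Layered = Fin t × (Vertex t (suc d) × Vertex t (suc d))

      -- Together with `cross` these are the three parts of a route through layer `c`. Also
      -- `descend` is written towards the layer, so that both ends are treated alike.
      climb descend : Layered → Step d
      climb (c , (u , w)) = tail u , (head u , c)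
      descend (c , (u , w)) = tail w , (head w , c)

      cross : Layered → Vertex t (suc d) × Vertex t (suc d)
      cross (c , (u , w)) = c ∷ tail u , c ∷ tail w

      via-layers : ∀ {E} (L : List Layered) N →
                   E ⊨ map (place ∘ climb) L ++ map (place ∘ descend) L ++ map cross L ++ N → E ⊨ map proj₂ L ++ N
      via-layers [] N e = e
      via-layers ((c , (a ∷ x , b ∷ y)) ∷ L) N e = ⊨-perm
        (⇆-solve 3 (λ p m n → (m ⇆⊕ (p ⇆⊕ n)) ⇆⊜ (p ⇆⊕ (m ⇆⊕ n))) ⇆-refl [ a ∷ x , b ∷ y ] (map proj₂ L) N)
        (via-layers L ((a ∷ x , b ∷ y) ∷ N) (⊨-perm
          (⇆-solve 5 (λ p l m r n → (p ⇆⊕ (l ⇆⊕ (m ⇆⊕ (r ⇆⊕ n)))) ⇆⊜ (l ⇆⊕ (m ⇆⊕ (r ⇆⊕ (p ⇆⊕ n))))) ⇆-refl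
            [ a ∷ x , b ∷ y ] (map (place ∘ climb) L) (map (place ∘ descend) L) (map cross L) N)
          (⊨-join (⊨-join (⊨-perm
            (⇆-trans (⇆-solve 7 (λ p q r l m s n → ((p ⇆⊕ l) ⇆⊕ ((q ⇆⊕ m) ⇆⊕ ((r ⇆⊕ s) ⇆⊕ n))) ⇆⊜ (p ⇆⊕ (r ⇆⊕ (q ⇆⊕ (l ⇆⊕ (m ⇆⊕ (s ⇆⊕ n))))))) ⇆-refl
              [ a ∷ x , c ∷ x ] [ b ∷ y , c ∷ y ] [ c ∷ x , c ∷ y ] (map (place ∘ climb) L) (map (place ∘ descend) L) (map cross L) N)
              (Hom.prep same (Hom.prep same (Hom.prep flip ⇆-refl)))) e)))))

      map-layers : ∀ {X Y : Set} (f : X → Y) n (F : Fin n → List X) → map f (concat (tabulate F)) ≡ concat (tabulate (map f ∘ F))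
      map-layers f n F = ≡-trans (sym (concat-map (tabulate F))) (cong concat (map-tabulate F (map f)))

      step-degree : Vertex t d → Fin t → Step d → ℕ
      step-degree x v (y , (a , c)) = V.δ d y x * (F.δ a v + F.δ c v)

      shadow : Demands → List (Vertex t d × Vertex t d)
      shadow = map (bimap tail tail)

    module Layers (d p : ℕ) (12p+12≤t : 12 * p + 12 ≤ t) (D : Demands d) (D≤ : ∀ v → V.deg (suc d) D v ≤ 2 * p)
                  (G : Fin t → Demands d) (D⇆ : D ⇆ concat (tabulate G)) (G≤ : ∀ c x → T.deg d (G c) x ≤ 2 * p)
                  (solve : ∀ C → (∀ v → V.deg d C v ≤ 2 * p) → grid d ⊨ C) where

      L : List (Layered d)
      L = concat (tabulate λ c → map (c ,_) (G c))

      S : List (Step d)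
      S = map (climb d) L ++ map (descend d) L

      L-demands : map proj₂ L ≡ concat (tabulate G)
      L-demands = ≡-trans (map-layers d proj₂ t _) (cong concat (tabulate-cong λ c → ≡-trans (sym (map-∘ (G c))) (map-id (G c))))

      L-cross : map (cross d) L ≡ concat (tabulate λ c → copy c (shadow d (G c)))
      L-cross = ≡-trans (map-layers d (cross d) t _) (cong concat (tabulate-cong λ c → ≡-trans (sym (map-∘ (G c))) (map-∘ (G c))))

      S-places : map place S ≡ map (place ∘ climb d) L ++ map (place ∘ descend d) L
      S-places = ≡-trans (map-++ place (map (climb d) L) (map (descend d) L)) (cong₂ _++_ (sym (map-∘ L)) (sym (map-∘ L)))

      open ≤-Reasoning

      ends-at : ∀ x v → tally (λ (c , (u , w)) → V.δ (suc d) u (v ∷ x) + V.δ (suc d) w (v ∷ x)) L ≤ 2 * p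
      ends-at x v = begin
        tally (λ (c , (u , w)) → V.δ (suc d) u (v ∷ x) + V.δ (suc d) w (v ∷ x)) L           ≡⟨ sym (tally-map (λ (u , w) → V.δ (suc d) u (v ∷ x) + V.δ (suc d) w (v ∷ x)) proj₂ L) ⟩
        tally (λ (u , w) → V.δ (suc d) u (v ∷ x) + V.δ (suc d) w (v ∷ x)) (map proj₂ L)     ≡⟨ tally-+ _ _ (map proj₂ L) ⟩
        V.deg (suc d) (map proj₂ L) (v ∷ x)                                                 ≡⟨ cong (λ M → V.deg (suc d) M (v ∷ x)) L-demands ⟩
        V.deg (suc d) (concat (tabulate G)) (v ∷ x)                                         ≡⟨ sym (V.deg-⇆ (suc d) D⇆ (v ∷ x)) ⟩
        V.deg (suc d) D (v ∷ x)                                                             ≤⟨ D≤ (v ∷ x) ⟩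
        2 * p                                                                               ∎

      -- Vertex `v` of the line over `x` is the entrance to layer `v` alone, and the demands of that
      -- layer have at most `2 * p` ends in this line.
      layer-at : ∀ x v → tally (λ (c , (u , w)) → (V.δ d (tail u) x + V.δ d (tail w) x) * F.δ c v) L ≤ 2 * p
      layer-at x v = begin
        tally (λ (c , (u , w)) → (V.δ d (tail u) x + V.δ d (tail w) x) * F.δ c v) L   ≡⟨ tally-tabulate t _ (λ c → map (c ,_) (G c)) ⟩
        tally (λ c → tally _ (map (c ,_) (G c))) (allFin t)                           ≡⟨ tally-cong one-layer (allFin t) ⟩
        tally (λ c → F.δ c v * T.deg d (G c) x) (allFin t)                            ≤⟨ tally-mono (λ c → ≤-trans (*-monoʳ-≤ (F.δ c v) (G≤ c x)) (≤-reflexive (*-comm (F.δ c v) (2 * p)))) (allFin t) ⟩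
        tally (λ c → 2 * p * F.δ c v) (allFin t)                                      ≡⟨ tally-* (2 * p) (λ c → F.δ c v) (allFin t) ⟩
        2 * p * F.μ (allFin t) v                                                      ≡⟨ cong (2 * p *_) (μ-allFin v) ⟩
        2 * p * 1                                                                     ≡⟨ *-identityʳ _ ⟩
        2 * p                                                                         ∎
        where
        one-layer : ∀ c → tally (λ (c , (u , w)) → (V.δ d (tail u) x + V.δ d (tail w) x) * F.δ c v) (map (c ,_) (G c)) ≡ F.δ c v * T.deg d (G c) x
        one-layer c = ≡-trans (tally-map _ (c ,_) (G c)) (≡-trans
          (tally-cong (λ (u , w) → *-comm (V.δ d (tail u) x + V.δ d (tail w) x) (F.δ c v)) (G c))
          (≡-trans (tally-* (F.δ c v) _ (G c)) (cong (F.δ c v *_) (tally-+ _ _ (G c)))))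

      line≤ : ∀ x v → F.deg (line x S) v ≤ 2 * (2 * p)
      line≤ x v = begin
        F.deg (line x S) v                                                                    ≡⟨ line-deg x S v ⟩
        tally h S                                                                             ≡⟨ tally-++ h (map (climb d) L) (map (descend d) L) ⟩
        tally h (map (climb d) L) + tally h (map (descend d) L)                               ≡⟨ cong₂ _+_ (tally-map h (climb d) L) (tally-map h (descend d) L) ⟩
        tally (h ∘ climb d) L + tally (h ∘ descend d) L                                       ≡⟨ sym (tally-+ _ _ L) ⟩
        tally (λ l → h (climb d l) + h (descend d l)) L                                       ≡⟨ tally-cong regroup L ⟩
        tally (λ l → ends l + layers l) L                                                     ≡⟨ tally-+ ends layers L ⟩
        tally ends L + tally layers L                                                         ≤⟨ +-mono-≤ (ends-at x v) (layer-at x v) ⟩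
        2 * p + 2 * p                                                                         ≡⟨ cong (2 * p +_) (sym (+-identityʳ (2 * p))) ⟩
        2 * (2 * p)                                                                           ∎
        where
        h : Step d → ℕ
        h = step-degree d x v
        ends layers : Layered d → ℕ
        ends (c , (u , w)) = V.δ (suc d) u (v ∷ x) + V.δ (suc d) w (v ∷ x)
        layers (c , (u , w)) = (V.δ d (tail u) x + V.δ d (tail w) x) * F.δ c v
        distribute : ∀ a b g e z → a * (g + z) + b * (e + z) ≡ a * g + b * e + (a + b) * z
        distribute = solve-∀
        regroup : ∀ l → h (climb d l) + h (descend d l) ≡ ends l + layers l
        regroup (c , (u , w)) = ≡-trans
          (distribute (V.δ d (tail u) x) (V.δ d (tail w) x) (F.δ (head u) v) (F.δ (head w) v) (F.δ c v))
          (cong (_+ layers (c , (u , w))) (sym (cong₂ _+_ (δ-head-tail u v x) (δ-head-tail w v x))))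

      lines : concatMap (λ x → within x (F.pairs (allFin t))) (allVertices d) ⊨ map place S
      lines = ⊨-perm (↭⇒⇆ (sort-lines S)) (⊨-concat (λ x → ⊨-map (_∷ x) (F.completeGraph (2 * p) (allFin t) (line x S)
        (λ v → ≤-reflexive (μ-allFin v))
        (≤-trans (≤-reflexive (lemma p)) (≤-trans 12p+12≤t (≤-reflexive (sym (length-tabulate {n = t} id)))))
        (λ v z → ⊥-elim (1+n≢0 (≡-trans (sym (μ-allFin v)) z)))
        (line≤ x))) (allVertices d))
        where
        lemma : ∀ p → 6 * (2 * p) + 12 ≡ 12 * p + 12
        lemma = solve-∀

      layers : concat (tabulate λ c → copy c (grid d)) ⊨ map (cross d) L
      layers = subst (concat (tabulate λ c → copy c (grid d)) ⊨_) (sym L-cross)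
        (⊨-tabulate t λ c → ⊨-map (c ∷_) (solve (shadow d (G c)) λ x → ≤-trans
          (≤-reflexive (cong₂ _+_ (tally-map _ (bimap tail tail) (G c)) (tally-map _ (bimap tail tail) (G c)))) (G≤ c x)))

      solution : grid (suc d) ⊨ D
      solution = ⊨-perm (⇆-trans (≡⇒⇆ (≡-trans (++-identityʳ _) L-demands)) (⇆-sym D⇆)) (via-layers d L []
        (⊨-perm (≡⇒⇆ (≡-trans (cong (_++ map (cross d) L) S-places)
          (≡-trans (++-assoc (map (place ∘ climb d) L) (map (place ∘ descend d) L) (map (cross d) L)) (cong (λ N → map (place ∘ climb d) L ++ map (place ∘ descend d) L ++ N) (sym (++-identityʳ (map (cross d) L)))))))
          (⊨-++ lines layers)))

  realizeGrid : ∀ p → 12 * p + 12 ≤ t → ∀ d D → (∀ v → V.deg d D v ≤ 2 * p) → grid d ⊨ D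
  -- Contraction produces loops even from loopless demands; on a single vertex there is nothing
  -- else.
  realizeGrid p le zero D D≤ = point D
    where
    point : ∀ D → [] ⊨ D
    point [] = ⊨-[]
    point (([] , []) ∷ D) = ⊨-loop (point D)
  realizeGrid p le (suc d) D D≤ with T.factorization d (t * p) D (λ x → ≤-trans (line-degree d (2 * p) D D≤ x) (≤-reflexive (lemma t p)))
    where
    lemma : ∀ t p → t * (2 * p) ≡ 2 * (t * p)
    lemma = solve-∀
  ... | Ms , len , mat , q with group d t p Ms len mat
  ... | G , eq , G≤ = Layers.solution d p le D D≤ G (⇆-trans q (≡⇒⇆ eq)) G≤ (realizeGrid p le d)

-- From routes to paths

-- Loops are exempt because `grid` contains the loop at a vertex once for every direction.
Once : ∀ {A : Set} → A × A → A × A → Set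
Once e f = e ∼ f → proj₁ e ≡ proj₂ e

module _ {A : Set} where

  loop-∼ : ∀ {e f : A × A} → e ∼ f → proj₁ e ≡ proj₂ e → proj₁ f ≡ proj₂ f
  loop-∼ same l = l
  loop-∼ flip l = sym l

  once-sym : ∀ {e f : A × A} → Once e f → Once f e
  once-sym o f∼e = loop-∼ (∼-sym f∼e) (o (∼-sym f∼e))

  once-⇆ : ∀ {D E : List (A × A)} → D ⇆ E → AllPairs Once D → AllPairs Once E
  once-⇆ = AllPairs-resp-⇆ (λ {e} {f} → once-sym {e} {f})
    ((λ f∼g o e∼g → o (∼-trans e∼g (∼-sym f∼g))) , (λ e∼g o g∼f → loop-∼ e∼g (o (∼-trans e∼g g∼f))))

  AllPairs-++⁻ : ∀ {R : A → A → Set} xs {ys x y} → AllPairs R (xs ++ ys) → x ∈ xs → y ∈ ys → R x y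
  AllPairs-++⁻ (x ∷ xs) (r ∷ _) (here refl) y∈ = All.lookup r (∈-++⁺ʳ xs y∈)
  AllPairs-++⁻ (x ∷ xs) (_ ∷ rs) (there x∈) y∈ = AllPairs-++⁻ xs rs x∈ y∈

module _ {t d : ℕ} where

  -- Loops may be consumed by routes, but they are not edges of the grid.
  Edge : Vertex t d × Vertex t d → Set
  Edge (u , v) = u ≡ v ⊎ Adj u v

  Adj-sym : {u v : Vertex t d} → Adj u v → Adj v u
  Adj-sym (i , neq , eq) = i , neq ∘ sym , λ j j≢i → sym (eq j j≢i)

  Edge-∼ : ∀ {e f} → e ∼ f → Edge e → Edge f
  Edge-∼ same e = e
  Edge-∼ flip (inj₁ eq) = inj₁ (sym eq)
  Edge-∼ (flip {a} {b}) (inj₂ adj) = inj₂ (Adj-sym {a} {b} adj)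

  private
    infix 4 _⊑_
    _⊑_ : ∀ {u v u' v' : Vertex t d} → Walk u v → Walk u' v' → Set
    w ⊑ w' = ∀ {e} → e ∈ walkEdges w → e ∈ walkEdges w'

    from : ∀ {x u v : Vertex t d} (w : Walk u v) → IsPath w → x ∈ walkVertices w → ∃ λ (w' : Walk x v) → IsPath w' × w' ⊑ w
    from (stop x) p (here refl) = stop x , p , id
    from w@(step _ _) p (here refl) = w , p , id
    from (step _ w) (_ ∷ p) (there x∈) with from w p x∈
    ... | w' , p' , sub = w' , p' , there ∘ sub

    fresh : ∀ {x : Vertex t d} xs → x ∉ xs → All (x ≢_) xs
    fresh [] _ = []
    fresh (y ∷ xs) x∉ = x∉ ∘ here ∷ fresh xs (x∉ ∘ there)

  -- Loop erasure from the far end: if `u` already lies on the path found for the remainder, the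
  -- part of that path starting at `u` is kept.
  asPath : ∀ {u v : Vertex t d} (r : Route u v) → All Edge (edges r) →
           ∃ λ (w : Walk u v) → IsPath w × (∀ {e} → e ∈ walkEdges w → e ∈ edges r)
  asPath stay [] = stop _ , [] ∷ [] , λ ()
  asPath (go w r) (e ∷ es) with asPath r es
  asPath (go w r) (inj₁ refl ∷ es) | p , path , sub = p , path , there ∘ sub
  asPath {u} (go w r) (inj₂ adj ∷ es) | p , path , sub with member? _≟V_ u (walkVertices p)
  ... | yes u∈ with from p path u∈
  ... | q , path' , sub' = q , path' , there ∘ sub ∘ sub'
  asPath {u} (go w r) (inj₂ adj ∷ es) | p , path , sub | no u∉ =
    step adj p , fresh (walkVertices p) u∉ ∷ path , λ { (here refl) → here refl ; (there e∈) → there (sub e∈) }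

  walkEdges-proper : ∀ {u v : Vertex t d} (w : Walk u v) {e} → e ∈ walkEdges w → proj₁ e ≢ proj₂ e
  walkEdges-proper (step (i , neq , _) w) (here refl) eq = neq (cong (λ x → lookup x i) eq)
  walkEdges-proper (step _ w) (there e∈) = walkEdges-proper w e∈

  routeAt : ∀ {D : MultiGraph t d} → Routes D → (i : Fin (length D)) → Route (proj₁ (lookupL D i)) (proj₂ (lookupL D i))
  routeAt (r ∷ ρ) zero = r
  routeAt (r ∷ ρ) (suc i) = routeAt ρ i

  edges∈used : ∀ {D : MultiGraph t d} (ρ : Routes D) i {e} → e ∈ edges (routeAt ρ i) → e ∈ used ρ
  edges∈used (r ∷ ρ) zero e∈ = ∈-++⁺ˡ e∈
  edges∈used (r ∷ ρ) (suc i) e∈ = ∈-++⁺ʳ (edges r) (edges∈used ρ i e∈)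

  once-apart : ∀ {D : MultiGraph t d} (ρ : Routes D) {S} → AllPairs Once (used ρ ++ S) → ∀ i j → i ≢ j →
               ∀ {e f} → e ∈ edges (routeAt ρ i) → f ∈ edges (routeAt ρ j) → Once e f
  once-apart (r ∷ ρ) o zero zero i≢j e∈ f∈ = ⊥-elim (i≢j refl)
  once-apart (r ∷ ρ) {S} o zero (suc j) i≢j e∈ f∈ =
    AllPairs-++⁻ (edges r) (subst (AllPairs Once) (++-assoc (edges r) (used ρ) S) o) e∈ (∈-++⁺ˡ (edges∈used ρ j f∈))
  once-apart (r ∷ ρ) {S} o (suc i) zero i≢j {e} {f} e∈ f∈ = once-sym {e = f} {e}
    (AllPairs-++⁻ (edges r) (subst (AllPairs Once) (++-assoc (edges r) (used ρ) S) o) f∈ (∈-++⁺ˡ (edges∈used ρ i e∈)))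
  once-apart (r ∷ ρ) {S} o (suc i) (suc j) i≢j = once-apart ρ
    (AllPairs-drop (edges r) (subst (AllPairs Once) (++-assoc (edges r) (used ρ) S) o)) i j (i≢j ∘ cong suc)
    where
    AllPairs-drop : ∀ {R : Vertex t d × Vertex t d → _ → Set} xs {ys} → AllPairs R (xs ++ ys) → AllPairs R ys
    AllPairs-drop [] rs = rs
    AllPairs-drop (x ∷ xs) (_ ∷ rs) = AllPairs-drop xs rs

  realizable : ∀ {E} {D : MultiGraph t d} → All Edge E → AllPairs Once E → E ⊨ D → Realizable D
  realizable {E} {D} ok once (routing ρ S u) = (λ i → proj₁ (path i)) , (λ i → proj₁ (proj₂ (path i))) , apart
    where
    ok' : All Edge (used ρ ++ S)
    ok' = All-resp-⇆ Edge-∼ (⇆-sym u) ok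
    path : ∀ i → ∃ λ (w : Walk (proj₁ (lookupL D i)) (proj₂ (lookupL D i))) →
           IsPath w × (∀ {e} → e ∈ walkEdges w → e ∈ edges (routeAt ρ i))
    path i = asPath (routeAt ρ i) (All.tabulate λ e∈ →
      All.lookup ok' (∈-++⁺ˡ (edges∈used ρ i e∈)))
    apart : ∀ i j → i ≢ j → ¬ ShareEdge (proj₁ (path i)) (proj₁ (path j))
    -- A shared edge would have to be a loop, and a `Walk` traverses none.
    apart i j i≢j (a , b , e∈ , f∈) = walkEdges-proper (proj₁ (path i)) e∈ (shared f∈)
      where
      meet : ∀ {f} → f ∈ walkEdges (proj₁ (path j)) → (a , b) ∼ f → a ≡ b
      meet f∈ = once-apart ρ (once-⇆ (⇆-sym u) once) i j i≢j (proj₂ (proj₂ (path i)) e∈) (proj₂ (proj₂ (path j)) f∈)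
      shared : (a , b) ∈ walkEdges (proj₁ (path j)) ⊎ (b , a) ∈ walkEdges (proj₁ (path j)) → a ≡ b
      shared (inj₁ f∈) = meet f∈ same
      shared (inj₂ f∈) = meet f∈ flip

∼-ends : ∀ {A : Set} {e f : A × A} → e ∼ f →
         (proj₁ e ≡ proj₁ f × proj₂ e ≡ proj₂ f) ⊎ (proj₁ e ≡ proj₂ f × proj₂ e ≡ proj₁ f)
∼-ends same = inj₁ (refl , refl)
∼-ends flip = inj₂ (refl , refl)

once-map : ∀ {A B : Set} {f : A → B} → (∀ {x y} → f x ≡ f y → x ≡ y) → ∀ {e e'} → Once e e' → Once (bimap f f e) (bimap f f e')
once-map {f = f} inj o e∼e' with ∼-ends e∼e'
... | inj₁ (p , q) with inj p | inj q
... | refl | refl = cong f (o same)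
once-map {f = f} inj o e∼e' | inj₂ (p , q) with inj p | inj q
... | refl | refl = cong f (o flip)

Both : ∀ {A K : Set} → (A → K) → K → A × A → Set
Both g k (u , v) = g u ≡ k × g v ≡ k

once-≢ : ∀ {A K : Set} (g : A → K) {k k'} → k ≢ k' → ∀ {E F} → All (Both g k) E → All (Both g k') F → All (λ e → All (Once e) F) E
once-≢ g k≢k' [] _ = []
once-≢ g {k} {k'} k≢k' (p ∷ ps) qs = mapAll (apart p) qs ∷ once-≢ g k≢k' ps qs
  where
  apart : ∀ {e f} → Both g k e → Both g k' f → Once e f
  apart (refl , _) (q , _) same = ⊥-elim (k≢k' q)
  apart (refl , _) (_ , q) flip = ⊥-elim (k≢k' q)

module _ {A : Set} (_≟_ : DecidableEquality A) where
  open Complete _≟_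
  open Indicator _≟_

  distinct⇒unique : ∀ V → Distinct V → Unique V
  distinct⇒unique [] _ = []
  distinct⇒unique (x ∷ V) V-distinct = avoid V x∉V ∷ distinct⇒unique V (λ v → m+n≤o⇒n≤o (δ x v) (V-distinct v))
    where
    x∉V : μ V x ≡ 0
    x∉V = n≤0⇒n≡0 (≤-pred (subst (λ n → n + μ V x ≤ 1) (δ-≡ {x} refl) (V-distinct x)))
    avoid : ∀ W → μ W x ≡ 0 → All (x ≢_) W
    avoid [] _ = []
    avoid (w ∷ W) z = differ ∷ avoid W (m+n≡0⇒n≡0 (δ w x) z)
      where
      differ : x ≢ w
      differ refl = 1+n≢0 (≡-trans (sym (δ-≡ {x} refl)) (m+n≡0⇒m≡0 (δ x x) z))

  pairs-ends : ∀ {P : A → Set} {V} → All P V → All (λ e → P (proj₁ e) × P (proj₂ e)) (pairs V)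
  pairs-ends [] = []
  pairs-ends {P} (p ∷ ps) = All.++⁺ (All.map⁺ (mapAll (p ,_) (p ∷ ps))) (pairs-ends ps)

  pairs-once : ∀ {V} → Unique V → AllPairs Once (pairs V)
  pairs-once [] = []
  pairs-once {x ∷ V} (x∉V ∷ V-unique) = AllPairs.++⁺
    (AllPairs.map⁺ (AllPairs.map star (x∉V ∷ V-unique))) (pairs-once V-unique)
    (All.map⁺ (universal (λ y → mapAll apart (pairs-ends x∉V)) (x ∷ V)))
    where
    star : ∀ {y z} → y ≢ z → Once (x , y) (x , z)
    star y≢z same = ⊥-elim (y≢z refl)
    star y≢z flip = refl
    apart : ∀ {y f} → x ≢ proj₁ f × x ≢ proj₂ f → Once (x , y) f
    apart (p , q) same = ⊥-elim (p refl)
    apart (p , q) flip = ⊥-elim (q refl)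

-- The resource list `grid` as the edge set of the grid

module GridEdges (t : ℕ) where
  open Grid t

  Flat Upright : ∀ {d} → Vertex t (suc d) × Vertex t (suc d) → Set
  Flat (u , v) = head u ≡ head v
  Upright (u , v) = tail u ≡ tail v

  flat-once : ∀ {d} {e f : Vertex t (suc d) × Vertex t (suc d)} → Upright e → Flat f → Once e f
  flat-once {e = (a ∷ x , b ∷ y)} up flat same = cong₂ _∷_ flat up
  flat-once {e = (a ∷ x , b ∷ y)} up flat flip = cong₂ _∷_ (sym flat) up

  grid-once : ∀ d → AllPairs Once (grid d)
  grid-once zero = []
  grid-once (suc d) = AllPairs.++⁺
    (AllPairs.concat⁺
      (All.map⁺ (universal (λ x → AllPairs.map⁺ (AllPairs.map (once-map (∷-injectiveˡ {xs = x}))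
        (pairs-once _≟F_ (allFin⁺ t)))) (allVertices d)))
      (AllPairs.map⁺ (AllPairs.map (λ {x} {y} x≢y → once-≢ tail x≢y (lines-at x) (lines-at y))
        (distinct⇒unique _≟V_ (allVertices d) (λ v → ≤-reflexive (μ-allVertices d v))))))
    (AllPairs.concat⁺
      (All.tabulate⁺ λ c → AllPairs.map⁺ (AllPairs.map (once-map ∷-injectiveʳ) (grid-once d)))
      (AllPairs.tabulate⁺ λ {c} {c'} c≢c' → once-≢ head c≢c' (copies-at c) (copies-at c')))
    (mapAll (λ {e} up → mapAll (λ {f} → flat-once {e = e} {f} up) flat) upright)
    where
    lines-at : ∀ x → All (Both tail x) (within x (F.pairs (allFin t)))
    lines-at x = All.map⁺ (universal (λ _ → refl , refl) _)
    copies-at : ∀ c → All (Both head c) (copy c (grid d))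
    copies-at c = All.map⁺ (universal (λ _ → refl , refl) _)
    upright : All Upright (concatMap (λ x → within x (F.pairs (allFin t))) (allVertices d))
    upright = All.concat⁺ (All.map⁺ (universal (λ x → All.map⁺ (universal (λ _ → refl) _)) (allVertices d)))
    flat : All Flat (concat (tabulate λ c → copy c (grid d)))
    flat = All.concat⁺ (All.tabulate⁺ {f = λ c → copy c (grid d)} λ c →
      All.map⁺ {f = bimap (c ∷_) (c ∷_)} (universal (λ _ → refl) (grid d)))

  line-edge : ∀ {d} (x : Vertex t d) a b → Edge (a ∷ x , b ∷ x)
  line-edge x a b with a ≟F b
  ... | yes refl = inj₁ refl
  ... | no a≢b = inj₂ (zero , a≢b , λ { zero z≢z → ⊥-elim (z≢z refl) ; (suc j) _ → refl })

  copy-edge : ∀ {d} c {e : Vertex t d × Vertex t d} → Edge e → Edge (bimap (c ∷_) (c ∷_) e)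
  copy-edge c (inj₁ refl) = inj₁ refl
  copy-edge c (inj₂ (i , neq , eq)) = inj₂ (suc i , neq , λ { zero _ → refl ; (suc j) neq' → eq j (neq' ∘ cong suc) })

  grid-edges : ∀ d → All Edge (grid d)
  grid-edges zero = []
  grid-edges (suc d) = All.++⁺
    (All.concat⁺ (All.map⁺ (universal (λ x → All.map⁺ (universal (λ (a , b) → line-edge x a b) _)) (allVertices d))))
    (All.concat⁺ (All.tabulate⁺ λ c → All.map⁺ (mapAll (copy-edge c) (grid-edges d))))

-- A loop counts twice in `deg` but once in `degree`, whence the hypothesis `Loopless`.
degree-deg : ∀ {t d} (D : MultiGraph t d) → Loopless D → ∀ v → Grid.V.deg t d D v ≡ degree D v
degree-deg [] _ v = refl
degree-deg {t} {d} ((a , b) ∷ D) loopless v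
  rewrite Grid.V.deg-∷ t d a b D v | degree-deg D (loopless ∘ there) v with a ≟V v | b ≟V v
... | yes refl | yes refl = ⊥-elim (loopless (here refl) refl)
... | yes _ | no _ = refl
... | no _ | yes _ = refl
... | no _ | no _ = refl

mainTheorem13 : (t d : ℕ) → 1 ≤ t → 1 ≤ d → (D : MultiGraph t d) → Loopless D →
    (∀ (v : Vertex t d) → degree D v + 2 ≤ 2 * (t / 12)) → Realizable D
mainTheorem13 t d _ _ D loopless degree≤ = cases (t / 12) refl D loopless degree≤
  where
  open GridEdges t
  open GridRouting t
  cases : ∀ q → t / 12 ≡ q → (D : MultiGraph t d) → Loopless D → (∀ v → degree D v + 2 ≤ 2 * q) → Realizable D
  cases zero _ [] _ _ = (λ ()) , (λ ()) , λ ()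
  -- For `t < 12` the degree bound fails at every vertex, in particular at an end of `e`.
  cases zero _ (e ∷ D) _ le = ⊥-elim (n≮0 (≤-trans (m≤n+m 2 (degree (e ∷ D) (proj₁ e))) (le (proj₁ e))))
  -- With `q = suc p` the permitted degree 2q - 2 is `2 * p`, and `12 * p + 12` is 12q, the largest
  -- multiple of 12 up to `t`.
  cases (suc p) eq D loopless le = realizable (grid-edges d) (grid-once d)
    (realizeGrid p 12p+12≤t d D λ v → +-cancelʳ-≤ 2 _ _ (≤-trans (≤-reflexive (cong (_+ 2) (degree-deg D loopless v)))
      (≤-trans (le v) (≤-reflexive (double p)))))
    where
    double : ∀ p → 2 * suc p ≡ 2 * p + 2
    double = solve-∀
    dozen : ∀ p → 12 * p + 12 ≡ suc p * 12
    dozen = solve-∀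
    12p+12≤t : 12 * p + 12 ≤ t
    12p+12≤t = ≤-trans (≤-reflexive (≡-trans (dozen p) (cong (_* 12) (sym eq)))) (m/n*n≤m t 12)
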